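{- Let $k>1$ and let $\alpha(y_1,\dots,y_k)=c\oplus y_1\oplus\cdots\oplus y_k$, with $c\in GF(2)$, be a linear $k$-adic connective. Consider the growth process $(\mu,\alpha)$ on $n$ variables and assume that the support of $\mu$ does not contain negations of the projections. (1) If $\{0,1\}\cap\mathrm{supp}(\mu)\neq\{0,1\}$ (i.e. at least one of the two constant functions is missing from the support of $\mu$), $k$ is odd and $c=1$, then the growth process has alternating limiting distributions, each of which is uniform over one half of the support of the growth process (which consists of all linear functions $c_0\oplus c_1x_1\oplus\cdots\oplus c_nx_n$ for which $\bigoplus_{j=1}^n c_j=1$). (2) In all other cases, the limiting distribution is uniform over the support of the growth process (which depends on $k$, $c$, and the presence of constants in the support of $\mu$).
   Context: A connective is a $k$-adic Boolean function $\alpha:\{0,1\}^k\to\{0,1\}$. Let $A_0=\{x_1,\dots,x_n,\bar x_1,\dots,\bar x_n,0,1\}$ be the set of projections on $n$ variables, their negations, and the two constant functions. The initial distribution $\mu$ is the uniform distribution on a subset of $A_0$ which contains the $n$ projections, may or may not contain their $n$ negations, and contains neither, one, or both constants. The growth process $(\mu,\alpha)$ gives distributions $\pi_i$ on $n$-adic Boolean functions: $\pi_0=\mu$, and for $i\ge1$, $\pi_i(f)$ is the probability that $\alpha(g_1,\dots,g_k)=f$ where $g_1,\dots,g_k$ are independent random functions distributed according to $\pi_{i-1}$. The support of a distribution $\pi$ is $\mathrm{supp}(\pi)=\{f: \pi(f)>0\}$; the support of the growth process is the set of all functions $f$ with $\pi_i(f)>0$ for some $i>0$. The limiting distribution is $\pi=\lim_{i\to\infty}\pi_i$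 (pointwise) when it exists. The process has alternating limiting distributions if $\pi_{2i}$ and $\pi_{2i+1}$ tend to distinct distributions as $i\to\infty$. A function is linear if it has the form $c_0\oplus c_1x_1\oplus\cdots\oplus c_nx_n$ with $c_0,c_1,\dots,c_n\in GF(2)$.
   Formalization: In (1) the description of the support by c_1⊕...⊕c_n = 1 is stated only if supp(μ) has no constant; with exactly one constant it is false (n=1, k=3, c=1, supp(μ)={x_1,0}: the constant 1 occurs), and the support is instead shown to be all linear functions. -}

module Defs where

open import Data.Bool using (Bool; true; false; not; _∧_; _xor_; if_then_else_)
open import Data.Bool.Properties using () renaming (_≟_ to _≟ᵇ_)
open import Data.Fin using (Fin)
open import Data.Integer using (+_)
open import Data.List using (List; []; _∷_; [_]; _++_; map; filter; foldr; length; cartesianProductWith; allFin)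
import Data.List.Membership.DecSetoid as DecMembership
open import Data.List.Membership.Propositional using () renaming (_∈_ to _∈≡_)
open import Data.List.Membership.Propositional.Properties using (∈-cartesianProductWith⁺)
import Data.List.Relation.Binary.Subset.Setoid as Subset
open import Data.List.Relation.Unary.All as All using (All)
open import Data.List.Relation.Unary.Any using (here; there)
import Data.List.Relation.Unary.Unique.Setoid as Uniqueness
open import Data.Nat as ℕ using (ℕ; zero; suc)
open import Data.Product using (_×_; ∃-syntax)
open import Data.Rational using (ℚ; 0ℚ; 1ℚ; _+_; _*_; _-_; _/_; _<_; ∣_∣)
open import Data.Vec as Vec using (Vec; []; _∷_; lookup; zipWith)
open import Function.Bundles using (_⇔_)
open import Level using (0ℓ)
open import Relation.Binary.Bundles using (DecSetoid; Setoid)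
open import Relation.Binary.PropositionalEquality using (_≡_; refl; _≗_; _→-setoid_)
open import Relation.Nullary using (Dec; does; ¬_)
open import Relation.Nullary.Decidable using (map′)

-- All vectors of length k with entries taken from the given list.
vectors : ∀ {a} {A : Set a} → List A → (k : ℕ) → List (Vec A k)
vectors xs zero    = [ [] ]
vectors xs (suc k) = cartesianProductWith _∷_ xs (vectors xs k)

inputs : (n : ℕ) → List (Vec Bool n)
inputs = vectors (false ∷ true ∷ [])

inputs-complete : ∀ {n} (v : Vec Bool n) → v ∈≡ inputs n
inputs-complete         []      = here refl
inputs-complete {suc n} (b ∷ v) =
  ∈-cartesianProductWith⁺ _∷_ {xs = false ∷ true ∷ []} {ys = inputs n} (bit∈ b) (inputs-complete v)
  where
  bit∈ : ∀ b → b ∈≡ false ∷ true ∷ []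
  bit∈ false = here refl
  bit∈ true  = there (here refl)

-- Boolean functions are identified when they agree pointwise (_≗_).
BoolFun : ℕ → Set
BoolFun n = Vec Bool n → Bool

infix 4 _≗?_
_≗?_ : ∀ {n} (f g : BoolFun n) → Dec (f ≗ g)
_≗?_ {n} f g = map′ (λ h v → All.lookup h (inputs-complete v))
                    (λ f≗g → All.tabulate (λ {v} _ → f≗g v))
                    (All.all? (λ v → f v ≟ᵇ g v) (inputs n))

boolFunDecSetoid : ℕ → DecSetoid 0ℓ 0ℓ
boolFunDecSetoid n = record
  { isDecEquivalence = record
    { isEquivalence = Setoid.isEquivalence (Vec Bool n →-setoid Bool)
    ; _≟_           = _≗?_
    }
  }

module _ {n : ℕ} where
  open DecMembership (boolFunDecSetoid n) public using (_∈_; _∈?_)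
  open Subset (DecSetoid.setoid (boolFunDecSetoid n)) public using (_⊆_)
  open Uniqueness (DecSetoid.setoid (boolFunDecSetoid n)) public using (Unique)

-- Every n-adic Boolean function occurs exactly once, up to _≗_: a function of
-- n + 1 variables is given by its restrictions to first argument 0 and 1.
allBoolFuns : (n : ℕ) → List (BoolFun n)
allBoolFuns zero    = (λ _ → false) ∷ (λ _ → true) ∷ []
allBoolFuns (suc n) = cartesianProductWith branch (allBoolFuns n) (allBoolFuns n)
  where
  branch : BoolFun n → BoolFun n → BoolFun (suc n)
  branch f₀ f₁ (b ∷ v) = if b then f₁ v else f₀ v

projection negatedProjection : ∀ {n} → Fin n → BoolFun n
projection        j v = lookup v j
negatedProjection j v = not (lookup v j)

constant : ∀ {n} → Bool → BoolFun n
constant b _ = b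

parity : ∀ {n} → Vec Bool n → Bool
parity = Vec.foldr′ _xor_ false

-- c₀ ⊕ c₁x₁ ⊕ ⋯ ⊕ cₙxₙ
linear : ∀ {n} → Bool → Vec Bool n → BoolFun n
linear c₀ c v = c₀ xor parity (zipWith _∧_ c v)

Linear : ∀ {n} → BoolFun n → Set
Linear f = ∃[ c₀ ] ∃[ c ] f ≗ linear c₀ c

-- c ⊕ y₁ ⊕ ⋯ ⊕ yₖ
linearConnective : ∀ k → Bool → BoolFun k
linearConnective k c y = c xor parity y

-- Weights are indexed by functions; every one used below respects _≗_.
Distribution : ℕ → Set
Distribution n = BoolFun n → ℚ

Supp : ∀ {n} → Distribution n → BoolFun n → Set
Supp p f = 0ℚ < p f

-- A finite set is a list without repetitions up to _≗_; on such a list this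
-- is the uniform distribution.
uniform : ∀ {n} → List (BoolFun n) → Distribution n
uniform []         f = 0ℚ
uniform S@(_ ∷ _)  f = if does (f ∈? S) then + 1 / length S else 0ℚ

record InitialChoice : Set where
  field
    withNegations withZero withOne : Bool

-- For n ≥ 1 the listed functions are pairwise distinct.
initialSet : ∀ n → InitialChoice → List (BoolFun n)
initialSet n A = map projection (allFin n)
              ++ (if withNegations then map negatedProjection (allFin n) else [])
              ++ (if withZero then [ constant false ] else [])
              ++ (if withOne then [ constant true ] else [])
  where open InitialChoice A

initial : ∀ {n} → InitialChoice → Distribution n
initial {n} A = uniform (initialSet n A)

compose : ∀ {n k} → BoolFun k → Vec (BoolFun n) k → BoolFun n
compose α gs v = α (Vec.map (λ g → g v) gs)

sumℚ : List ℚ → ℚ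
sumℚ = foldr _+_ 0ℚ

productℚ : ∀ {k} → Vec ℚ k → ℚ
productℚ = Vec.foldr′ _*_ 1ℚ

growth : ∀ {n k} → Distribution n → BoolFun k → ℕ → Distribution n
growth             μ α zero    f = μ f
growth {n} {k}     μ α (suc i) f =
  sumℚ (map (λ gs → productℚ (Vec.map (growth μ α i) gs))
            (filter (λ gs → compose α gs ≗? f) (vectors (allBoolFuns n) k)))

ProcessSupp : ∀ {n} → (ℕ → Distribution n) → BoolFun n → Set
ProcessSupp π f = ∃[ i ] 0 ℕ.< i × Supp (π i) f

infix 4 _⟶_
_⟶_ : ∀ {n} → (ℕ → Distribution n) → Distribution n → Set
π ⟶ p = ∀ f (ε : ℚ) → 0ℚ < ε → ∃[ N ] ∀ i → N ℕ.≤ i → ∣ π i f - p f ∣ < ε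

AlternatingLimits : ∀ {n} → (ℕ → Distribution n) → Distribution n → Distribution n → Set
AlternatingLimits π p q =
  ((λ i → π (2 ℕ.* i)) ⟶ p) × ((λ i → π (suc (2 ℕ.* i))) ⟶ q) × ¬ (p ≗ q)

infix 4 _Enumerates_ _HalfOf_
_Enumerates_ : ∀ {n} → List (BoolFun n) → (BoolFun n → Set) → Set
S Enumerates P = Unique S × (∀ f → f ∈ S ⇔ P f)

_HalfOf_ : ∀ {n} → List (BoolFun n) → List (BoolFun n) → Set
H HalfOf S = Unique H × H ⊆ S × 2 ℕ.* length H ≡ length S

{-# OPTIONS --safe #-}
module Submission where

-- Boolean functions form an elementary abelian 2-group under pointwise sum mod
-- 2, with characters char T : f ↦ (-1)^⟨ T , f ⟩, one for every Boolean function
-- T. Let E i T be the expectation of char T under the i-th distribution. As the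
-- connective is c plus the sum of its arguments, which are independent,
--   E (i + 1) T = char T c * (E i T)^k                        (𝔼-char-suc).
-- Call T balanced if char T is constant on the initial functions, and let
-- seed i be the function grown from the projection x₁ alone. If T is balanced,
-- then E i T = char T (seed i), a sign (𝔼-balanced). Otherwise cancellation
-- gives ∣ E 0 T ∣ ≤ ρ for some ρ < 1, and k > 1 gives ∣ E i T ∣ ≤ ρ^(i+1)
-- (𝔼-unbalanced).
--
-- Let coset s consist of the functions that no balanced T distinguishes from s.
-- These are the cosets of one subgroup, so they all have the same size, and the
-- Fourier coefficients of the uniform distribution on coset (seed i) are
-- char T (seed i) for balanced T and 0 otherwise (card*uniform-coset). Fourier
-- inversion bounds its distance from the i-th distribution by ρ^(i+1) at every
-- function (approximation). The i-th distribution is also supported in that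
-- coset (vanishes-off-coset), so only the movement of coset (seed i) matters.
--
-- For even k, seed (i + 1) is the constant c; for odd k it is c + seed i. Hence
-- the coset is fixed from i = 1 on, and the limit is uniform on it (stationary),
-- unless k is odd, c = 1 and some balanced T has ⟨ T , 1 ⟩ = 1; then it alternates
-- between two disjoint cosets of equal size (module Alternating). Such a T exists
-- exactly if a constant is missing initially: if both are present, every balanced
-- T has ⟨ T , 1 ⟩ = ⟨ T , 0 ⟩ = 0; if one is missing, evaluation at 0…0 or at 1…1
-- will do (separating).
--
-- In the alternating case the union of the two cosets is found by testing
-- suitable T. The functionals f(u) + f(v) + f(u + v) + f(0) vanish on all initial
-- functions, so they are balanced and force linearity (coset-linear). Without
-- initial constants f(0…0) + f(1…1) is balanced as well and forces the parity
-- condition (coset-odd). Conversely a balanced T takes one value on all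
-- projections, which determines it on every linear function (linear-in-coset).

open import Defs
open import Data.Bool using (Bool; true; false)
open import Data.List using (List)
open import Data.Nat using (ℕ; _<_; _≤_; _%_)
open import Data.Product using (_×_; ∃-syntax)
open import Data.Sum using (_⊎_)
open import Function.Bundles using (_⇔_)
open import Relation.Binary.PropositionalEquality using (_≡_; _≗_)
open import Relation.Nullary using (¬_)

open import Data.Bool using (not; _∧_; _xor_; if_then_else_)
import Data.Bool.Properties as 𝔹
open import Data.Bool.Solver using (module xor-∧-Solver)
open import Data.Empty using (⊥-elim)
open import Data.Fin using (Fin; zero; suc)
import Data.Fin as Fin
open import Data.Nat.DivMod using (m%n<n)
open import Data.Integer using () renaming (+_ to pos)
import Data.Integer as ℤ
import Data.Integer.Properties as ℤₚ
open import Data.List using ([]; _∷_; [_]; _++_; map; filter; length; cartesianProductWith; allFin; tabulate)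
import Data.List.Properties as Listₚ
import Data.List.Membership.Setoid.Properties as ∈ₚ
open import Data.List.Relation.Unary.All as All using (All; []; _∷_)
import Data.List.Relation.Unary.All.Properties as Allₚ
open import Data.List.Relation.Unary.AllPairs using ([]; _∷_)
open import Data.List.Relation.Unary.Any as Any using (Any; here; there)
import Data.List.Relation.Unary.Any.Properties as Anyₚ
import Data.List.Relation.Unary.Unique.Setoid.Properties as Uniqueₚ
open import Data.Nat using (zero; suc; s≤s; z≤n)
import Data.Nat as ℕ
import Data.Nat.Properties as ℕₚ
open import Data.Product using (_,_; proj₁; proj₂; ∃)
open import Data.Rational using (ℚ; 0ℚ; 1ℚ; _+_; _*_; _-_; -_; ∣_∣; _/_)
  renaming (_≤_ to _≤ℚ_; _<_ to _<ℚ_)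
import Data.Rational as ℚ
import Data.Rational.Properties as ℚₚ
open import Data.Rational.Solver using (module +-*-Solver)
import Data.Rational.Unnormalised as ℚᵘ
import Data.Rational.Unnormalised.Properties as ℚᵘₚ
open import Data.Sum as Sum using (inj₁; inj₂; [_,_]′)
open import Data.Unit using (⊤; tt)
open import Data.Vec as Vec using (Vec; []; _∷_; lookup; zipWith; replicate)
import Data.Vec.Properties as Vecₚ
open import Function using (_∘_; id; case_of_)
open import Function.Bundles using (mk⇔)
open import Level using (0ℓ)
open import Relation.Binary.Bundles using (DecSetoid; Setoid)
open import Relation.Binary.PropositionalEquality
  using (refl; sym; trans; cong; cong₂; subst; subst₂; setoid; module ≡-Reasoning)
open import Relation.Binary.Definitions using (tri<; tri≈; tri>)
open import Relation.Nullary using (Dec; yes; no; does)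
open import Relation.Nullary.Decidable using (_×-dec_; decidable-stable; map′; dec-true; dec-false; does-⇔)
open import Relation.Unary using (Pred; Decidable)

-- Finite sums of rationals

∑ : ∀ {a} {A : Set a} → List A → (A → ℚ) → ℚ
∑ xs F = sumℚ (map F xs)

card : ∀ {a} {A : Set a} → List A → ℚ
card xs = ∑ xs (λ _ → 1ℚ)

-- Iverson bracket of a decided proposition.
𝟙 : ∀ {p} {P : Set p} → Dec P → ℚ
𝟙 P? = if does P? then 1ℚ else 0ℚ

module _ {p} {P : Set p} where

  𝟙-yes : (P? : Dec P) → P → 𝟙 P? ≡ 1ℚ
  𝟙-yes P? x = cong (if_then 1ℚ else 0ℚ) (dec-true P? x)

  𝟙-no : (P? : Dec P) → ¬ P → 𝟙 P? ≡ 0ℚ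
  𝟙-no P? ¬x = cong (if_then 1ℚ else 0ℚ) (dec-false P? ¬x)

𝟙-cong : ∀ {p q} {P : Set p} {Q : Set q} (P? : Dec P) (Q? : Dec Q) →
         (P → Q) → (Q → P) → 𝟙 P? ≡ 𝟙 Q?
𝟙-cong P? Q? f g = cong (if_then 1ℚ else 0ℚ) (does-⇔ (mk⇔ f g) P? Q?)

module _ {a} {A : Set a} where

  ∑-cong : ∀ (xs : List A) {F G} → F ≗ G → ∑ xs F ≡ ∑ xs G
  ∑-cong xs F≗G = cong sumℚ (Listₚ.map-cong F≗G xs)

  ∑-zero : ∀ (xs : List A) → ∑ xs (λ _ → 0ℚ) ≡ 0ℚ
  ∑-zero []       = refl
  ∑-zero (x ∷ xs) = trans (ℚₚ.+-identityˡ _) (∑-zero xs)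

  ∑-++ : ∀ (xs ys : List A) F → ∑ (xs ++ ys) F ≡ ∑ xs F + ∑ ys F
  ∑-++ []       ys F = sym (ℚₚ.+-identityˡ _)
  ∑-++ (x ∷ xs) ys F = trans (cong (F x +_) (∑-++ xs ys F)) (sym (ℚₚ.+-assoc (F x) (∑ xs F) (∑ ys F)))

  ∑-+ : ∀ (xs : List A) F G → ∑ xs (λ x → F x + G x) ≡ ∑ xs F + ∑ xs G
  ∑-+ []       F G = refl
  ∑-+ (x ∷ xs) F G = trans (cong (F x + G x +_) (∑-+ xs F G))
    (solve 4 (λ a b c d → (a :+ b) :+ (c :+ d) := (a :+ c) :+ (b :+ d)) refl
      (F x) (G x) (∑ xs F) (∑ xs G))
    where
    open +-*-Solver

  ∑-*ˡ : ∀ (xs : List A) c F → ∑ xs (λ x → c * F x) ≡ c * ∑ xs F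
  ∑-*ˡ []       c F = sym (ℚₚ.*-zeroʳ c)
  ∑-*ˡ (x ∷ xs) c F = trans (cong (c * F x +_) (∑-*ˡ xs c F)) (sym (ℚₚ.*-distribˡ-+ c _ _))

  ∑-*ʳ : ∀ (xs : List A) c F → ∑ xs (λ x → F x * c) ≡ ∑ xs F * c
  ∑-*ʳ xs c F = trans (∑-cong xs (λ x → ℚₚ.*-comm (F x) c)) (trans (∑-*ˡ xs c F) (ℚₚ.*-comm c _))

  ∑-neg : ∀ (xs : List A) F → ∑ xs (λ x → - F x) ≡ - ∑ xs F
  ∑-neg []       F = refl
  ∑-neg (x ∷ xs) F = trans (cong (- F x +_) (∑-neg xs F)) (sym (ℚₚ.neg-distrib-+ (F x) _))

  ∑-filter : ∀ {p} {P : Pred A p} (P? : Decidable P) xs F →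
             ∑ (filter P? xs) F ≡ ∑ xs (λ x → 𝟙 (P? x) * F x)
  ∑-filter P? []       F = refl
  ∑-filter P? (x ∷ xs) F with P? x
  ... | yes _ = cong₂ _+_ (sym (ℚₚ.*-identityˡ (F x))) (∑-filter P? xs F)
  ... | no  _ = trans (∑-filter P? xs F)
                  (sym (trans (cong (_+ _) (ℚₚ.*-zeroˡ (F x))) (ℚₚ.+-identityˡ _)))

  ∣∑∣-bound : ∀ (xs : List A) F c → (∀ x → ∣ F x ∣ ≤ℚ c) → ∣ ∑ xs F ∣ ≤ℚ card xs * c
  ∣∑∣-bound []       F c F≤c = ℚₚ.≤-reflexive (sym (ℚₚ.*-zeroˡ c))
  ∣∑∣-bound (x ∷ xs) F c F≤c = begin
    ∣ F x + ∑ xs F ∣           ≤⟨ ℚₚ.∣p+q∣≤∣p∣+∣q∣ (F x) _ ⟩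
    ∣ F x ∣ + ∣ ∑ xs F ∣       ≤⟨ ℚₚ.+-mono-≤ (F≤c x) (∣∑∣-bound xs F c F≤c) ⟩
    c + card xs * c            ≡⟨ cong (_+ card xs * c) (sym (ℚₚ.*-identityˡ c)) ⟩
    1ℚ * c + card xs * c       ≡⟨ sym (ℚₚ.*-distribʳ-+ c 1ℚ (card xs)) ⟩
    (1ℚ + card xs) * c         ∎
    where
    open ℚₚ.≤-Reasoning

∑-map : ∀ {a b} {A : Set a} {B : Set b} (g : A → B) xs F → ∑ (map g xs) F ≡ ∑ xs (F ∘ g)
∑-map g xs F = cong sumℚ (sym (Listₚ.map-∘ xs))

∑-swap : ∀ {a b} {A : Set a} {B : Set b} (xs : List A) (ys : List B) (F : A → B → ℚ) →
         ∑ xs (λ x → ∑ ys (F x)) ≡ ∑ ys (λ y → ∑ xs (λ x → F x y))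
∑-swap []       ys F = sym (∑-zero ys)
∑-swap (x ∷ xs) ys F = trans (cong (∑ ys (F x) +_) (∑-swap xs ys F)) (sym (∑-+ ys (F x) (λ y → ∑ xs (λ x → F x y))))

∑-cartesianProductWith :
  ∀ {a b c} {A : Set a} {B : Set b} {C : Set c} (_•_ : A → B → C) xs ys F →
  ∑ (cartesianProductWith _•_ xs ys) F ≡ ∑ xs (λ x → ∑ ys (λ y → F (x • y)))
∑-cartesianProductWith _•_ []       ys F = refl
∑-cartesianProductWith _•_ (x ∷ xs) ys F =
  trans (∑-++ (map (x •_) ys) _ F)
        (cong₂ _+_ (∑-map (x •_) ys F) (∑-cartesianProductWith _•_ xs ys F))

infixr 8 _^_
_^_ : ℚ → ℕ → ℚ
x ^ zero  = 1ℚ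
x ^ suc k = x * x ^ k

-- The k-fold product of a sum, expanded.
∑-vectors : ∀ {a} {A : Set a} (xs : List A) k (F : A → ℚ) →
            ∑ (vectors xs k) (λ v → productℚ (Vec.map F v)) ≡ (∑ xs F) ^ k
∑-vectors xs zero    F = refl
∑-vectors xs (suc k) F = begin
  ∑ (vectors xs (suc k)) (λ v → productℚ (Vec.map F v))
    ≡⟨ ∑-cartesianProductWith _∷_ xs (vectors xs k) (λ v → productℚ (Vec.map F v)) ⟩
  ∑ xs (λ x → ∑ (vectors xs k) (λ v → F x * productℚ (Vec.map F v)))
    ≡⟨ ∑-cong xs (λ x → ∑-*ˡ (vectors xs k) (F x) _) ⟩
  ∑ xs (λ x → F x * ∑ (vectors xs k) (λ v → productℚ (Vec.map F v)))
    ≡⟨ ∑-*ʳ xs _ F ⟩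
  ∑ xs F * ∑ (vectors xs k) (λ v → productℚ (Vec.map F v))
    ≡⟨ cong (∑ xs F *_) (∑-vectors xs k F) ⟩
  ∑ xs F * (∑ xs F) ^ k ∎
  where
  open ≡-Reasoning

fromℕ : ℕ → ℚ
fromℕ m = pos m / 1

fromℕ-suc : ∀ m → 1ℚ + fromℕ m ≡ fromℕ (suc m)
fromℕ-suc m = ℚₚ.toℚᵘ-injective (begin-equality
  ℚ.toℚᵘ (1ℚ + fromℕ m)                ≃⟨ ℚₚ.toℚᵘ-homo-+ 1ℚ (fromℕ m) ⟩
  ℚ.toℚᵘ 1ℚ ℚᵘ.+ ℚ.toℚᵘ (fromℕ m)      ≃⟨ ℚᵘₚ.+-congʳ (ℚ.toℚᵘ 1ℚ) (ℚₚ.toℚᵘ-fromℚᵘ (ℚᵘ.mkℚᵘ (pos m) 0)) ⟩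
  ℚ.toℚᵘ 1ℚ ℚᵘ.+ ℚᵘ.mkℚᵘ (pos m) 0       ≃⟨ ℚᵘ.*≡* (cong (λ z → (ℤ.1ℤ ℤ.+ z) ℤ.* ℤ.1ℤ) (ℤₚ.*-identityʳ (pos m))) ⟩
  ℚᵘ.mkℚᵘ (pos (suc m)) 0                  ≃⟨ ℚᵘₚ.≃-sym (ℚₚ.toℚᵘ-fromℚᵘ (ℚᵘ.mkℚᵘ (pos (suc m)) 0)) ⟩
  ℚ.toℚᵘ (fromℕ (suc m))               ∎)
  where
  open ℚᵘₚ.≤-Reasoning

fromℕ-injective : ∀ {m p} → fromℕ m ≡ fromℕ p → m ≡ p
fromℕ-injective {m} {p} eq with ℚₚ.fromℚᵘ-injective {ℚᵘ.mkℚᵘ (pos m) 0} {ℚᵘ.mkℚᵘ (pos p) 0} eq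
... | ℚᵘ.*≡* h = ℤₚ.+-injective (trans (sym (ℤₚ.*-identityʳ (pos m))) (trans h (ℤₚ.*-identityʳ (pos p))))

card-length : ∀ {a} {A : Set a} (xs : List A) → card xs ≡ fromℕ (length xs)
card-length []       = refl
card-length (x ∷ xs) = trans (cong (1ℚ +_) (card-length xs)) (fromℕ-suc (length xs))

/-inverse : ∀ m → (pos 1 / suc m) * fromℕ (suc m) ≡ 1ℚ
/-inverse m = ℚₚ.toℚᵘ-injective (begin-equality
  ℚ.toℚᵘ ((pos 1 / suc m) * fromℕ (suc m))              ≃⟨ ℚₚ.toℚᵘ-homo-* (pos 1 / suc m) (fromℕ (suc m)) ⟩
  ℚ.toℚᵘ (pos 1 / suc m) ℚᵘ.* ℚ.toℚᵘ (fromℕ (suc m))    ≃⟨ ℚᵘₚ.*-cong (ℚₚ.toℚᵘ-fromℚᵘ (ℚᵘ.mkℚᵘ (pos 1) m))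
                                                              (ℚₚ.toℚᵘ-fromℚᵘ (ℚᵘ.mkℚᵘ (pos (suc m)) 0)) ⟩
  ℚᵘ.mkℚᵘ (pos 1) m ℚᵘ.* ℚᵘ.mkℚᵘ (pos (suc m)) 0            ≃⟨ ℚᵘ.*≡* (trans (ℤₚ.*-identityʳ _)
                                                              (cong (λ z → pos 1 ℤ.* pos z) (sym (ℕₚ.*-identityʳ (suc m))))) ⟩
  ℚᵘ.1ℚᵘ                                              ∎)
  where
  open ℚᵘₚ.≤-Reasoning

p≡-p⇒p≡0 : ∀ {p} → p ≡ - p → p ≡ 0ℚ
p≡-p⇒p≡0 {p} p≡-p = begin
  p                 ≡⟨ solve 1 (λ x → x := con ℚ.½ :* (x :+ x)) refl p ⟩
  ℚ.½ * (p + p)     ≡⟨ cong (λ z → ℚ.½ * (p + z)) p≡-p ⟩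
  ℚ.½ * (p + - p)   ≡⟨ cong (ℚ.½ *_) (ℚₚ.+-inverseʳ p) ⟩
  0ℚ                ∎
  where
  open ≡-Reasoning
  open +-*-Solver

-- The group of Boolean functions under pointwise addition

infixl 6 _⊕_
_⊕_ : ∀ {n} → BoolFun n → BoolFun n → BoolFun n
(f ⊕ g) v = f v xor g v

xor-cancelʳ : ∀ x y → (x xor y) xor y ≡ x
xor-cancelʳ x y = trans (𝔹.xor-assoc x y y) (trans (cong (x xor_) (𝔹.xor-same y)) (𝔹.xor-identityʳ x))

xor≡false⇒≡ : ∀ a b → a xor b ≡ false → a ≡ b
xor≡false⇒≡ false b eq = sym eq
xor≡false⇒≡ true  b eq = sym (trans (sym (𝔹.not-involutive b)) (cong not eq))

-- Invariance under pointwise equality.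
Respects : ∀ {a n} {A : Set a} → (BoolFun n → A) → Set a
Respects F = ∀ f g → f ≗ g → F f ≡ F g

BoolFunSetoid : ℕ → Setoid 0ℓ 0ℓ
BoolFunSetoid n = DecSetoid.setoid (boolFunDecSetoid n)

allBoolFuns-unique : ∀ n → Unique (allBoolFuns n)
allBoolFuns-unique zero    = ((λ eq → case eq [] of λ ()) ∷ []) ∷ [] ∷ []
allBoolFuns-unique (suc n) =
  Uniqueₚ.cartesianProductWith⁺ (BoolFunSetoid n) (BoolFunSetoid n) (BoolFunSetoid (suc n)) _
    (λ eq → (λ v → eq (false ∷ v)) , (λ v → eq (true ∷ v)))
    (allBoolFuns-unique n) (allBoolFuns-unique n)

allBoolFuns-complete : ∀ {n} (f : BoolFun n) → f ∈ allBoolFuns n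
allBoolFuns-complete {zero} f with f [] in eq
... | false = here λ where [] → eq
... | true  = there (here λ where [] → eq)
allBoolFuns-complete {suc n} f =
  ∈ₚ.∈-resp-≈ (BoolFunSetoid (suc n))
    (λ where (false ∷ v) → refl
             (true  ∷ v) → refl)
    (∈ₚ.∈-cartesianProductWith⁺ (BoolFunSetoid n) (BoolFunSetoid n) (BoolFunSetoid (suc n))
      (λ where p q (false ∷ v) → p v
               p q (true  ∷ v) → q v)
      (allBoolFuns-complete (λ v → f (false ∷ v)))
      (allBoolFuns-complete (λ v → f (true ∷ v))))

module _ {n : ℕ} where

  private
    all : List (BoolFun n)
    all = allBoolFuns n

  ∈-resp-≗ : ∀ {f g : BoolFun n} {xs} → f ≗ g → f ∈ xs → g ∈ xs
  ∈-resp-≗ = ∈ₚ.∈-resp-≈ (BoolFunSetoid n)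

  𝟙-∈-∷ : ∀ f g {xs} → All (λ h → ¬ g ≗ h) xs →
          𝟙 (f ∈? g ∷ xs) ≡ 𝟙 (f ≗? g) + 𝟙 (f ∈? xs)
  𝟙-∈-∷ f g {xs} g∉xs = by-cases (f ≗? g)
    where
    by-cases : Dec (f ≗ g) → 𝟙 (f ∈? g ∷ xs) ≡ 𝟙 (f ≗? g) + 𝟙 (f ∈? xs)
    by-cases (yes f≗g) = trans (𝟙-yes (f ∈? g ∷ xs) (here f≗g))
      (sym (cong₂ _+_ (𝟙-yes (f ≗? g) f≗g)
        (𝟙-no (f ∈? xs) (λ f∈xs → Allₚ.All¬⇒¬Any g∉xs (∈-resp-≗ f≗g f∈xs)))))
    by-cases (no f≇g) = trans
      (𝟙-cong (f ∈? g ∷ xs) (f ∈? xs)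
        (λ where (here f≗g)   → ⊥-elim (f≇g f≗g)
                 (there f∈xs) → f∈xs)
        there)
      (sym (trans (cong (_+ 𝟙 (f ∈? xs)) (𝟙-no (f ≗? g) f≇g)) (ℚₚ.+-identityˡ (𝟙 (f ∈? xs)))))

  -- A sum over a repetition-free list picks out a single function.
  ∑-pick : ∀ {xs} → Unique xs → ∀ (F : BoolFun n → ℚ) → Respects F → ∀ h →
           ∑ xs (λ f → 𝟙 (f ≗? h) * F f) ≡ 𝟙 (h ∈? xs) * F h
  ∑-pick {[]}     []           F F-resp h = sym (ℚₚ.*-zeroˡ (F h))
  ∑-pick {x ∷ xs} (x∉xs ∷ xs!) F F-resp h = begin
    𝟙 (x ≗? h) * F x + ∑ xs (λ f → 𝟙 (f ≗? h) * F f)  ≡⟨ cong₂ _+_ head (∑-pick xs! F F-resp h) ⟩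
    𝟙 (h ≗? x) * F h + 𝟙 (h ∈? xs) * F h              ≡⟨ sym (ℚₚ.*-distribʳ-+ (F h) (𝟙 (h ≗? x)) (𝟙 (h ∈? xs))) ⟩
    (𝟙 (h ≗? x) + 𝟙 (h ∈? xs)) * F h                  ≡⟨ cong (_* F h) (sym (𝟙-∈-∷ h x x∉xs)) ⟩
    𝟙 (h ∈? x ∷ xs) * F h                             ∎
    where
    open ≡-Reasoning
    head : 𝟙 (x ≗? h) * F x ≡ 𝟙 (h ≗? x) * F h
    head = by-cases (x ≗? h)
      where
      by-cases : Dec (x ≗ h) → 𝟙 (x ≗? h) * F x ≡ 𝟙 (h ≗? x) * F h
      by-cases (yes x≗h) = cong₂ _*_
        (trans (𝟙-yes (x ≗? h) x≗h) (sym (𝟙-yes (h ≗? x) (λ v → sym (x≗h v)))))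
        (F-resp x h x≗h)
      by-cases (no x≇h) = trans
        (trans (cong (_* F x) (𝟙-no (x ≗? h) x≇h)) (ℚₚ.*-zeroˡ (F x)))
        (sym (trans (cong (_* F h) (𝟙-no (h ≗? x) (λ h≗x → x≇h (λ v → sym (h≗x v)))))
                    (ℚₚ.*-zeroˡ (F h))))

  ∑-all-pick : ∀ (F : BoolFun n → ℚ) → Respects F → ∀ h →
               ∑ all (λ f → 𝟙 (f ≗? h) * F f) ≡ F h
  ∑-all-pick F F-resp h = trans (∑-pick (allBoolFuns-unique n) F F-resp h)
    (trans (cong (_* F h) (𝟙-yes (h ∈? all) (allBoolFuns-complete h))) (ℚₚ.*-identityˡ (F h)))

  -- Translation by h permutes the group.
  ∑-translate : ∀ (F : BoolFun n → ℚ) → Respects F → ∀ h →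
                ∑ all (λ f → F (f ⊕ h)) ≡ ∑ all F
  ∑-translate F F-resp h = begin
    ∑ all (λ f → F (f ⊕ h))
      ≡⟨ ∑-cong all (λ f → sym (∑-all-pick F F-resp (f ⊕ h))) ⟩
    ∑ all (λ f → ∑ all (λ g → 𝟙 (g ≗? f ⊕ h) * F g))
      ≡⟨ ∑-swap all all (λ f g → 𝟙 (g ≗? f ⊕ h) * F g) ⟩
    ∑ all (λ g → ∑ all (λ f → 𝟙 (g ≗? f ⊕ h) * F g))
      ≡⟨ ∑-cong all (λ g → ∑-cong all (λ f → cong (_* F g) (move f g))) ⟩
    ∑ all (λ g → ∑ all (λ f → 𝟙 (f ≗? g ⊕ h) * F g))
      ≡⟨ ∑-cong all (λ g → ∑-all-pick (λ _ → F g) (λ _ _ _ → refl) (g ⊕ h)) ⟩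
    ∑ all F ∎
    where
    open ≡-Reasoning
    move : ∀ f g → 𝟙 (g ≗? f ⊕ h) ≡ 𝟙 (f ≗? g ⊕ h)
    move f g = 𝟙-cong (g ≗? f ⊕ h) (f ≗? g ⊕ h)
      (λ eq v → trans (sym (xor-cancelʳ (f v) (h v))) (cong (_xor h v) (sym (eq v))))
      (λ eq v → trans (sym (xor-cancelʳ (g v) (h v))) (cong (_xor h v) (sym (eq v))))

  ∑-antisymmetric : ∀ (F : BoolFun n → ℚ) → Respects F → ∀ h →
                    (∀ f → F (f ⊕ h) ≡ - F f) → ∑ all F ≡ 0ℚ
  ∑-antisymmetric F F-resp h anti = p≡-p⇒p≡0 (begin
    ∑ all F                   ≡⟨ sym (∑-translate F F-resp h) ⟩
    ∑ all (λ f → F (f ⊕ h))   ≡⟨ ∑-cong all anti ⟩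
    ∑ all (λ f → - F f)       ≡⟨ ∑-neg all F ⟩
    - ∑ all F                 ∎)
    where
    open ≡-Reasoning

-- The pairing of Boolean functions and its characters

-- The scalar product of truth tables over GF(2), unfolded along the branching
-- on the first argument.
⟨_,_⟩ : ∀ {n} → BoolFun n → BoolFun n → Bool
⟨_,_⟩ {zero}  T f = T [] ∧ f []
⟨_,_⟩ {suc n} T f = ⟨ T ∘ (false ∷_) , f ∘ (false ∷_) ⟩ xor ⟨ T ∘ (true ∷_) , f ∘ (true ∷_) ⟩

⟨⟩-cong : ∀ {n} {S T f g : BoolFun n} → S ≗ T → f ≗ g → ⟨ S , f ⟩ ≡ ⟨ T , g ⟩
⟨⟩-cong {zero}  p q = cong₂ _∧_ (p []) (q [])
⟨⟩-cong {suc n} p q = cong₂ _xor_ (⟨⟩-cong (p ∘ (false ∷_)) (q ∘ (false ∷_)))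
                                  (⟨⟩-cong (p ∘ (true ∷_)) (q ∘ (true ∷_)))

⟨⟩-comm : ∀ {n} (T f : BoolFun n) → ⟨ T , f ⟩ ≡ ⟨ f , T ⟩
⟨⟩-comm {zero}  T f = 𝔹.∧-comm (T []) (f [])
⟨⟩-comm {suc n} T f = cong₂ _xor_ (⟨⟩-comm (T ∘ (false ∷_)) (f ∘ (false ∷_)))
                                  (⟨⟩-comm (T ∘ (true ∷_)) (f ∘ (true ∷_)))

⟨⟩-⊕ʳ : ∀ {n} (T f g : BoolFun n) → ⟨ T , f ⊕ g ⟩ ≡ ⟨ T , f ⟩ xor ⟨ T , g ⟩
⟨⟩-⊕ʳ {zero}  T f g = 𝔹.∧-distribˡ-xor (T []) (f []) (g [])
⟨⟩-⊕ʳ {suc n} T f g = trans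
  (cong₂ _xor_ (⟨⟩-⊕ʳ (T ∘ (false ∷_)) (f ∘ (false ∷_)) (g ∘ (false ∷_)))
               (⟨⟩-⊕ʳ (T ∘ (true ∷_)) (f ∘ (true ∷_)) (g ∘ (true ∷_))))
  (solve 4 (λ a b c d → (a :+ b) :+ (c :+ d) := (a :+ c) :+ (b :+ d)) refl
    ⟨ T ∘ (false ∷_) , f ∘ (false ∷_) ⟩ ⟨ T ∘ (false ∷_) , g ∘ (false ∷_) ⟩
    ⟨ T ∘ (true ∷_) , f ∘ (true ∷_) ⟩ ⟨ T ∘ (true ∷_) , g ∘ (true ∷_) ⟩)
  where
  open xor-∧-Solver

⟨⟩-⊕ˡ : ∀ {n} (S T f : BoolFun n) → ⟨ S ⊕ T , f ⟩ ≡ ⟨ S , f ⟩ xor ⟨ T , f ⟩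
⟨⟩-⊕ˡ S T f = trans (⟨⟩-comm (S ⊕ T) f)
  (trans (⟨⟩-⊕ʳ f S T) (cong₂ _xor_ (⟨⟩-comm f S) (⟨⟩-comm f T)))

⟨⟩-zeroʳ : ∀ {n} (T : BoolFun n) → ⟨ T , constant false ⟩ ≡ false
⟨⟩-zeroʳ {zero}  T = 𝔹.∧-zeroʳ (T [])
⟨⟩-zeroʳ {suc n} T = cong₂ _xor_ (⟨⟩-zeroʳ (T ∘ (false ∷_))) (⟨⟩-zeroʳ (T ∘ (true ∷_)))

⟨⟩-zeroˡ : ∀ {n} (f : BoolFun n) → ⟨ constant false , f ⟩ ≡ false
⟨⟩-zeroˡ f = trans (⟨⟩-comm (constant false) f) (⟨⟩-zeroʳ f)

-- The indicator function of a point.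
δ : ∀ {n} → Vec Bool n → BoolFun n
δ []          _           = true
δ (true  ∷ v) (b ∷ w) = b ∧ δ v w
δ (false ∷ v) (b ∷ w) = not b ∧ δ v w

⟨δ,⟩ : ∀ {n} (v : Vec Bool n) f → ⟨ δ v , f ⟩ ≡ f v
⟨δ,⟩ []          f = refl
⟨δ,⟩ (true  ∷ v) f = cong₂ _xor_ (⟨⟩-zeroˡ (f ∘ (false ∷_))) (⟨δ,⟩ v (f ∘ (true ∷_)))
⟨δ,⟩ (false ∷ v) f = trans (cong₂ _xor_ (⟨δ,⟩ v (f ∘ (false ∷_))) (⟨⟩-zeroˡ (f ∘ (true ∷_))))
                           (𝔹.xor-identityʳ _)

sgn : Bool → ℚ
sgn false = 1ℚ
sgn true  = - 1ℚ

sgn-xor : ∀ a b → sgn (a xor b) ≡ sgn a * sgn b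
sgn-xor false b     = sym (ℚₚ.*-identityˡ (sgn b))
sgn-xor true  false = refl
sgn-xor true  true  = refl

sgn-not : ∀ a → sgn (not a) ≡ - sgn a
sgn-not false = refl
sgn-not true  = refl

∣sgn∣ : ∀ a → ∣ sgn a ∣ ≡ 1ℚ
∣sgn∣ false = refl
∣sgn∣ true  = refl

char : ∀ {n} → BoolFun n → BoolFun n → ℚ
char T f = sgn ⟨ T , f ⟩

-- The sum over a subgroup P of the characters at h is the order of P or zero,
-- according to whether h is annihilated by P.
module Annihilator {n} (P : BoolFun n → Set) (P? : Decidable P)
  (P-resp : ∀ {f g} → f ≗ g → P f → P g)
  (P-⊕ : ∀ {f g} → P f → P g → P (f ⊕ g)) where

  private
    all : List (BoolFun n)
    all = allBoolFuns n

  order : ℚ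
  order = ∑ all (𝟙 ∘ P?)

  -- The annihilator of P.
  P⊥ : BoolFun n → Set
  P⊥ h = ∀ T → P T → ⟨ T , h ⟩ ≡ false

  P⊥-or-witness : ∀ h → P⊥ h ⊎ ∃ λ T → P T × ⟨ T , h ⟩ ≡ true
  P⊥-or-witness h with Any.any? (λ T → P? T ×-dec (⟨ T , h ⟩ 𝔹.≟ true)) all
  ... | yes found = inj₂ (Any.satisfied found)
  ... | no  none  = inj₁ λ T PT → 𝔹.¬-not λ Th → none
    (Any.map (λ T≗S → P-resp T≗S PT , trans (sym (⟨⟩-cong T≗S (λ _ → refl))) Th)
             (allBoolFuns-complete T))

  P⊥? : Decidable P⊥
  P⊥? h with P⊥-or-witness h
  ... | inj₁ h⊥             = yes h⊥
  ... | inj₂ (T , PT , Th)  = no λ h⊥ → case trans (sym Th) (h⊥ T PT) of λ ()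

  𝟙-resp : Respects (𝟙 ∘ P?)
  𝟙-resp f g f≗g = 𝟙-cong (P? f) (P? g) (P-resp f≗g) (P-resp (λ v → sym (f≗g v)))

  ∑-characters : ∀ h → ∑ all (λ T → 𝟙 (P? T) * char T h) ≡ 𝟙 (P⊥? h) * order
  ∑-characters h = [ annihilated , not-annihilated ]′ (P⊥-or-witness h)
    where
    open ≡-Reasoning
    annihilated : P⊥ h → ∑ all (λ T → 𝟙 (P? T) * char T h) ≡ 𝟙 (P⊥? h) * order
    annihilated h⊥ = begin
      ∑ all (λ T → 𝟙 (P? T) * char T h)  ≡⟨ ∑-cong all (λ T → term T (P? T)) ⟩
      order                              ≡⟨ sym (ℚₚ.*-identityˡ order) ⟩
      1ℚ * order                         ≡⟨ cong (_* order) (sym (𝟙-yes (P⊥? h) h⊥)) ⟩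
      𝟙 (P⊥? h) * order                  ∎
      where
      term : ∀ T (d : Dec (P T)) → 𝟙 d * char T h ≡ 𝟙 d
      term T (yes PT) = cong (λ b → 1ℚ * sgn b) (h⊥ T PT)
      term T (no  _)  = ℚₚ.*-zeroˡ (char T h)

    not-annihilated : (∃ λ T → P T × ⟨ T , h ⟩ ≡ true) →
                      ∑ all (λ T → 𝟙 (P? T) * char T h) ≡ 𝟙 (P⊥? h) * order
    not-annihilated (T₀ , PT₀ , T₀h) = begin
      ∑ all (λ T → 𝟙 (P? T) * char T h)
        ≡⟨ ∑-antisymmetric _ resp T₀ anti ⟩
      0ℚ
        ≡⟨ sym (ℚₚ.*-zeroˡ order) ⟩
      0ℚ * order
        ≡⟨ cong (_* order) (sym (𝟙-no (P⊥? h) (λ h⊥ → case trans (sym T₀h) (h⊥ T₀ PT₀) of λ ()))) ⟩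
      𝟙 (P⊥? h) * order ∎
      where
      resp : Respects (λ T → 𝟙 (P? T) * char T h)
      resp S T S≗T = cong₂ _*_ (𝟙-resp S T S≗T) (cong sgn (⟨⟩-cong S≗T (λ _ → refl)))
      -- Translation by a T₀ in P with ⟨ T₀ , h ⟩ = 1 changes the sign of every term.
      anti : ∀ T → 𝟙 (P? (T ⊕ T₀)) * char (T ⊕ T₀) h ≡ - (𝟙 (P? T) * char T h)
      anti T = begin
        𝟙 (P? (T ⊕ T₀)) * char (T ⊕ T₀) h
          ≡⟨ cong₂ _*_
               (𝟙-cong (P? (T ⊕ T₀)) (P? T)
                 (λ p → P-resp (λ v → xor-cancelʳ (T v) (T₀ v)) (P-⊕ p PT₀))
                 (λ p → P-⊕ p PT₀))
               (trans (cong sgn (trans (⟨⟩-⊕ˡ T T₀ h)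
                        (trans (cong (⟨ T , h ⟩ xor_) T₀h) (𝔹.xor-comm ⟨ T , h ⟩ true))))
                      (sgn-not ⟨ T , h ⟩)) ⟩
        𝟙 (P? T) * - char T h
          ≡⟨ sym (ℚₚ.neg-distribʳ-* (𝟙 (P? T)) (char T h)) ⟩
        - (𝟙 (P? T) * char T h) ∎

module _ {n : ℕ} where

  private
    all : List (BoolFun n)
    all = allBoolFuns n

    module Full = Annihilator {n} (λ _ → ⊤) (λ _ → yes tt) (λ _ _ → tt) (λ _ _ → tt)

  ∑-all-charactersˡ : ∀ h → ∑ all (λ T → char T h) ≡ 𝟙 (h ≗? constant false) * card all
  ∑-all-charactersˡ h = begin
    ∑ all (λ T → char T h)             ≡⟨ ∑-cong all (λ T → sym (ℚₚ.*-identityˡ (char T h))) ⟩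
    ∑ all (λ T → 1ℚ * char T h)        ≡⟨ Full.∑-characters h ⟩
    𝟙 (Full.P⊥? h) * card all          ≡⟨ cong (_* card all) (𝟙-cong (Full.P⊥? h) (h ≗? constant false)
                                            (λ h⊥ v → trans (sym (⟨δ,⟩ v h)) (h⊥ (δ v) tt))
                                            (λ h≗0 T _ → trans (⟨⟩-cong {S = T} (λ _ → refl) h≗0) (⟨⟩-zeroʳ T))) ⟩
    𝟙 (h ≗? constant false) * card all ∎
    where
    open ≡-Reasoning

  ∑-all-charactersʳ : ∀ T → ∑ all (char T) ≡ 𝟙 (T ≗? constant false) * card all
  ∑-all-charactersʳ T = trans (∑-cong all (λ f → cong sgn (⟨⟩-comm T f))) (∑-all-charactersˡ T)

  -- Fourier inversion.
  ∑-inversion : ∀ (F : BoolFun n → ℚ) → Respects F → ∀ h →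
                ∑ all (λ T → ∑ all (λ f → F f * char T f) * char T h) ≡ card all * F h
  ∑-inversion F F-resp h = begin
    ∑ all (λ T → ∑ all (λ f → F f * char T f) * char T h)
      ≡⟨ ∑-cong all (λ T → sym (∑-*ʳ all (char T h) (λ f → F f * char T f))) ⟩
    ∑ all (λ T → ∑ all (λ f → (F f * char T f) * char T h))
      ≡⟨ ∑-swap all all (λ T f → (F f * char T f) * char T h) ⟩
    ∑ all (λ f → ∑ all (λ T → (F f * char T f) * char T h))
      ≡⟨ ∑-cong all (λ f → trans (∑-cong all (regroup f))
           (∑-*ˡ all (F f) (λ T → char T (f ⊕ h)))) ⟩
    ∑ all (λ f → F f * ∑ all (λ T → char T (f ⊕ h)))
      ≡⟨ ∑-cong all (λ f → trans (cong (F f *_) (∑-all-charactersˡ (f ⊕ h)))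
           (trans (cong (λ z → F f * (z * card all)) (f⊕h f)) (rotate f))) ⟩
    ∑ all (λ f → card all * (𝟙 (f ≗? h) * F f))
      ≡⟨ ∑-*ˡ all (card all) (λ f → 𝟙 (f ≗? h) * F f) ⟩
    card all * ∑ all (λ f → 𝟙 (f ≗? h) * F f)
      ≡⟨ cong (card all *_) (∑-all-pick F F-resp h) ⟩
    card all * F h ∎
    where
    open ≡-Reasoning
    regroup : ∀ f T → (F f * char T f) * char T h ≡ F f * char T (f ⊕ h)
    regroup f T = trans (ℚₚ.*-assoc (F f) (char T f) (char T h))
      (cong (F f *_) (trans (sym (sgn-xor ⟨ T , f ⟩ ⟨ T , h ⟩)) (cong sgn (sym (⟨⟩-⊕ʳ T f h)))))
    f⊕h : ∀ f → 𝟙 (f ⊕ h ≗? constant false) ≡ 𝟙 (f ≗? h)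
    f⊕h f = 𝟙-cong (f ⊕ h ≗? constant false) (f ≗? h)
      (λ eq v → trans (sym (xor-cancelʳ (f v) (h v))) (cong (_xor h v) (eq v)))
      (λ eq v → trans (cong (_xor h v) (eq v)) (𝔹.xor-same (h v)))
    rotate : ∀ f → F f * (𝟙 (f ≗? h) * card all) ≡ card all * (𝟙 (f ≗? h) * F f)
    rotate f = solve 3 (λ a b c → a :* (b :* c) := c :* (b :* a)) refl (F f) (𝟙 (f ≗? h)) (card all)
      where
      open +-*-Solver

-- Geometric decay

*-mono-≤ : ∀ {a b c d} → a ≤ℚ b → 0ℚ ≤ℚ b → 0ℚ ≤ℚ c → c ≤ℚ d → a * c ≤ℚ b * d
*-mono-≤ {a} {b} {c} {d} a≤b 0≤b 0≤c c≤d = ℚₚ.≤-trans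
  (ℚₚ.*-monoʳ-≤-nonNeg c {{ℚ.nonNegative 0≤c}} a≤b)
  (ℚₚ.*-monoˡ-≤-nonNeg b {{ℚ.nonNegative 0≤b}} c≤d)

0≤* : ∀ {a b} → 0ℚ ≤ℚ a → 0ℚ ≤ℚ b → 0ℚ ≤ℚ a * b
0≤* {a} {b} 0≤a 0≤b = ℚₚ.≤-trans (ℚₚ.≤-reflexive (sym (ℚₚ.*-zeroʳ a)))
  (ℚₚ.*-monoˡ-≤-nonNeg a {{ℚ.nonNegative 0≤a}} 0≤b)

0≤1 : 0ℚ ≤ℚ 1ℚ
0≤1 = ℚₚ.nonNegative⁻¹ 1ℚ

0≤^ : ∀ {x} → 0ℚ ≤ℚ x → ∀ i → 0ℚ ≤ℚ x ^ i
0≤^ 0≤x zero    = 0≤1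
0≤^ 0≤x (suc i) = 0≤* 0≤x (0≤^ 0≤x i)

∣^∣≤1 : ∀ x → ∣ x ∣ ≤ℚ 1ℚ → ∀ j → ∣ x ^ j ∣ ≤ℚ 1ℚ
∣^∣≤1 x ∣x∣≤1 zero    = ℚₚ.≤-refl
∣^∣≤1 x ∣x∣≤1 (suc j) = begin
  ∣ x * x ^ j ∣        ≡⟨ ℚₚ.∣p*q∣≡∣p∣*∣q∣ x (x ^ j) ⟩
  ∣ x ∣ * ∣ x ^ j ∣    ≤⟨ *-mono-≤ ∣x∣≤1 0≤1 (ℚₚ.0≤∣p∣ (x ^ j)) (∣^∣≤1 x ∣x∣≤1 j) ⟩
  1ℚ                   ∎
  where
  open ℚₚ.≤-Reasoning

0≤fromℕ : ∀ m → 0ℚ ≤ℚ fromℕ m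
0≤fromℕ zero    = ℚₚ.≤-refl
0≤fromℕ (suc m) = ℚₚ.≤-trans (ℚₚ.+-mono-≤ 0≤1 (0≤fromℕ m)) (ℚₚ.≤-reflexive (fromℕ-suc m))

card-nonneg : ∀ {a} {A : Set a} (xs : List A) → 0ℚ ≤ℚ card xs
card-nonneg xs = subst (0ℚ ≤ℚ_) (sym (card-length xs)) (0≤fromℕ (length xs))

-- The denominator of x serves as N.
archimedean : ∀ x → 0ℚ <ℚ x → ∃ λ N → 1ℚ ≤ℚ fromℕ N * x
archimedean x@(ℚ.mkℚ (pos (suc a)) d _) 0<x = suc d , ℚₚ.toℚᵘ-cancel-≤ (begin
  ℚᵘ.1ℚᵘ
    ≤⟨ ℚᵘ.*≤* (ℤ.+≤+ bound) ⟩
  ℚᵘ.mkℚᵘ (pos (suc d)) 0 ℚᵘ.* ℚᵘ.mkℚᵘ (pos (suc a)) d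
    ≃⟨ ℚᵘₚ.*-congʳ (ℚᵘₚ.≃-sym (ℚₚ.toℚᵘ-fromℚᵘ (ℚᵘ.mkℚᵘ (pos (suc d)) 0))) ⟩
  ℚ.toℚᵘ (fromℕ (suc d)) ℚᵘ.* ℚ.toℚᵘ x
    ≃⟨ ℚᵘₚ.≃-sym (ℚₚ.toℚᵘ-homo-* (fromℕ (suc d)) x) ⟩
  ℚ.toℚᵘ (fromℕ (suc d) * x) ∎)
  where
  open ℚᵘₚ.≤-Reasoning
  bound : suc (d ℕ.+ 0 ℕ.+ 0) ≤ suc d ℕ.* suc a ℕ.* 1
  bound = ℕₚ.≤-trans
    (ℕₚ.≤-reflexive (cong suc (trans (ℕₚ.+-identityʳ _) (ℕₚ.+-identityʳ d))))
    (ℕₚ.≤-trans (ℕₚ.m≤m*n (suc d) (suc a)) (ℕₚ.≤-reflexive (sym (ℕₚ.*-identityʳ _))))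
archimedean (ℚ.mkℚ (pos zero) d _)    0<x = ⊥-elim (ℤ.Positive.pos (ℚ.positive 0<x))
archimedean (ℚ.mkℚ ℤ.-[1+ a ] d _)    0<x = ⊥-elim (ℤ.Positive.pos (ℚ.positive 0<x))

-- Powers of ρ = 1 - w tend to zero.
module Decay {ρ w : ℚ} (0≤ρ : 0ℚ ≤ℚ ρ) (0<w : 0ℚ <ℚ w) (w+ρ≡1 : w + ρ ≡ 1ℚ) where

  ρ≤1 : ρ ≤ℚ 1ℚ
  ρ≤1 = begin
    ρ        ≡⟨ sym (ℚₚ.+-identityˡ ρ) ⟩
    0ℚ + ρ   ≤⟨ ℚₚ.+-monoˡ-≤ ρ (ℚₚ.<⇒≤ 0<w) ⟩
    w + ρ    ≡⟨ w+ρ≡1 ⟩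
    1ℚ       ∎
    where
    open ℚₚ.≤-Reasoning

  ^-antimono : ∀ N d → ρ ^ (d ℕ.+ N) ≤ℚ ρ ^ N
  ^-antimono N zero    = ℚₚ.≤-refl
  ^-antimono N (suc d) = begin
    ρ * ρ ^ (d ℕ.+ N)    ≤⟨ *-mono-≤ ρ≤1 0≤1 (0≤^ 0≤ρ (d ℕ.+ N)) (^-antimono N d) ⟩
    1ℚ * ρ ^ N           ≡⟨ ℚₚ.*-identityˡ (ρ ^ N) ⟩
    ρ ^ N                ∎
    where
    open ℚₚ.≤-Reasoning

  -- Bernoulli's inequality (1/ρ)^i ≥ 1 + i w, with denominators cleared.
  bernoulli : ∀ i → ρ ^ i * (1ℚ + fromℕ i * w) ≤ℚ 1ℚ
  bernoulli zero    = ℚₚ.≤-reflexive (trans (ℚₚ.*-identityˡ _)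
                        (trans (cong (1ℚ +_) (ℚₚ.*-zeroˡ w)) (ℚₚ.+-identityʳ 1ℚ)))
  bernoulli (suc i) = begin
    ρ * ρ ^ i * (1ℚ + fromℕ (suc i) * w)
      ≡⟨ cong (λ z → ρ * ρ ^ i * (1ℚ + z * w)) (sym (fromℕ-suc i)) ⟩
    ρ * ρ ^ i * (1ℚ + (1ℚ + m) * w)
      ≡⟨ solve 4 (λ r p m w → r :* p :* (con 1ℚ :+ (con 1ℚ :+ m) :* w)
                            := p :* (r :* (con 1ℚ :+ (con 1ℚ :+ m) :* w))) refl ρ (ρ ^ i) m w ⟩
    ρ ^ i * (ρ * (1ℚ + (1ℚ + m) * w))
      ≤⟨ ℚₚ.*-monoˡ-≤-nonNeg (ρ ^ i) {{ℚ.nonNegative (0≤^ 0≤ρ i)}} step ⟩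
    ρ ^ i * (1ℚ + m * w)
      ≤⟨ bernoulli i ⟩
    1ℚ ∎
    where
    open ℚₚ.≤-Reasoning
    open +-*-Solver
    m : ℚ
    m = fromℕ i
    step : ρ * (1ℚ + (1ℚ + m) * w) ≤ℚ 1ℚ + m * w
    step = begin
      ρ * (1ℚ + (1ℚ + m) * w)
        ≡⟨ sym (ℚₚ.+-identityʳ _) ⟩
      ρ * (1ℚ + (1ℚ + m) * w) + 0ℚ
        ≤⟨ ℚₚ.+-monoʳ-≤ (ρ * (1ℚ + (1ℚ + m) * w))
             (0≤* (0≤* (ℚₚ.<⇒≤ 0<w) (ℚₚ.<⇒≤ 0<w)) (ℚₚ.+-mono-≤ 0≤1 (0≤fromℕ i))) ⟩
      ρ * (1ℚ + (1ℚ + m) * w) + w * w * (1ℚ + m)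
        ≡⟨ solve 3 (λ r m w → r :* (con 1ℚ :+ (con 1ℚ :+ m) :* w) :+ w :* w :* (con 1ℚ :+ m)
                           := r :+ (w :+ r) :* ((con 1ℚ :+ m) :* w)) refl ρ m w ⟩
      ρ + (w + ρ) * ((1ℚ + m) * w)
        ≡⟨ cong (λ z → ρ + z * ((1ℚ + m) * w)) w+ρ≡1 ⟩
      ρ + 1ℚ * ((1ℚ + m) * w)
        ≡⟨ solve 3 (λ r m w → r :+ con 1ℚ :* ((con 1ℚ :+ m) :* w) := (w :+ r) :+ m :* w) refl ρ m w ⟩
      (w + ρ) + m * w
        ≡⟨ cong (_+ m * w) w+ρ≡1 ⟩
      1ℚ + m * w ∎

  -- By the previous bound, any N with N w ε ≥ 1 will do.
  decay : ∀ ε → 0ℚ <ℚ ε → ∃ λ N → ∀ i → N ≤ i → ρ ^ i <ℚ ε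
  decay ε 0<ε = N , λ i N≤i → ℚₚ.≤-<-trans
    (subst (λ z → ρ ^ z ≤ℚ ρ ^ N) (ℕₚ.m∸n+n≡m N≤i) (^-antimono N (i ℕ.∸ N)))
    (ℚₚ.*-cancelʳ-<-nonNeg (1ℚ + fromℕ N * w) {{ℚ.nonNegative 0≤factor}} (begin-strict
      ρ ^ N * (1ℚ + fromℕ N * w)   ≤⟨ bernoulli N ⟩
      1ℚ                           ≤⟨ proj₂ large ⟩
      fromℕ N * (w * ε)            ≡⟨ sym (ℚₚ.+-identityˡ _) ⟩
      0ℚ + fromℕ N * (w * ε)       <⟨ ℚₚ.+-monoˡ-< (fromℕ N * (w * ε)) 0<ε ⟩
      ε + fromℕ N * (w * ε)        ≡⟨ solve 3 (λ e m w → e :+ m :* (w :* e) := e :* (con 1ℚ :+ m :* w)) refl ε (fromℕ N) w ⟩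
      ε * (1ℚ + fromℕ N * w)       ∎))
    where
    open ℚₚ.≤-Reasoning
    open +-*-Solver
    instance
      w-pos = ℚ.positive 0<w
      ε-pos = ℚ.positive 0<ε
    large : ∃ λ N → 1ℚ ≤ℚ fromℕ N * (w * ε)
    large = archimedean (w * ε) (ℚₚ.positive⁻¹ (w * ε) {{ℚₚ.pos*pos⇒pos w ε}})
    N : ℕ
    N = proj₁ large
    0≤factor : 0ℚ ≤ℚ 1ℚ + fromℕ N * w
    0≤factor = ℚₚ.+-mono-≤ 0≤1 (0≤* (0≤fromℕ N) (ℚₚ.<⇒≤ 0<w))

-- Uniform distributions

-- The weight of a point in a uniform distribution on m + 1 points.
weight : ℕ → ℚ
weight m = pos 1 / suc m

weight-card : ∀ {a} {A : Set a} (x : A) xs → weight (length xs) * card (x ∷ xs) ≡ 1ℚ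
weight-card x xs = trans (cong (weight (length xs) *_) (card-length (x ∷ xs))) (/-inverse (length xs))

0<weight : ∀ m → 0ℚ <ℚ weight m
0<weight m = ℚₚ.positive⁻¹ (weight m) {{ℚₚ.normalize-pos 1 (suc m)}}

module _ {n : ℕ} where

  private
    all : List (BoolFun n)
    all = allBoolFuns n

  ∑-all-∈ : ∀ {S} → Unique S → ∀ (F : BoolFun n → ℚ) → Respects F →
            ∑ all (λ f → 𝟙 (f ∈? S) * F f) ≡ ∑ S F
  ∑-all-∈ {[]}     []           F F-resp = trans (∑-cong all (λ f → ℚₚ.*-zeroˡ (F f))) (∑-zero all)
  ∑-all-∈ {g ∷ S}  (g∉S ∷ S!)   F F-resp = begin
    ∑ all (λ f → 𝟙 (f ∈? g ∷ S) * F f)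
      ≡⟨ ∑-cong all (λ f → trans (cong (_* F f) (𝟙-∈-∷ f g g∉S))
                                 (ℚₚ.*-distribʳ-+ (F f) (𝟙 (f ≗? g)) (𝟙 (f ∈? S)))) ⟩
    ∑ all (λ f → 𝟙 (f ≗? g) * F f + 𝟙 (f ∈? S) * F f)
      ≡⟨ ∑-+ all (λ f → 𝟙 (f ≗? g) * F f) (λ f → 𝟙 (f ∈? S) * F f) ⟩
    ∑ all (λ f → 𝟙 (f ≗? g) * F f) + ∑ all (λ f → 𝟙 (f ∈? S) * F f)
      ≡⟨ cong₂ _+_ (∑-all-pick F F-resp g) (∑-all-∈ S! F F-resp) ⟩
    F g + ∑ S F ∎
    where
    open ≡-Reasoning

  uniform-∷ : ∀ g S (f : BoolFun n) → uniform (g ∷ S) f ≡ weight (length S) * 𝟙 (f ∈? g ∷ S)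
  uniform-∷ g S f = lemma (does (f ∈? g ∷ S))
    where
    lemma : ∀ b → (if b then weight (length S) else 0ℚ) ≡ weight (length S) * (if b then 1ℚ else 0ℚ)
    lemma true  = sym (ℚₚ.*-identityʳ (weight (length S)))
    lemma false = sym (ℚₚ.*-zeroʳ (weight (length S)))

  uniform-card : ∀ S (f : BoolFun n) → card S * uniform S f ≡ 𝟙 (f ∈? S)
  uniform-card []      f = refl
  uniform-card (g ∷ S) f = begin
    card (g ∷ S) * uniform (g ∷ S) f                         ≡⟨ cong (card (g ∷ S) *_) (uniform-∷ g S f) ⟩
    card (g ∷ S) * (weight (length S) * 𝟙 (f ∈? g ∷ S))      ≡⟨ solve 3 (λ a b c → a :* (b :* c) := (b :* a) :* c) refl
                                                                  (card (g ∷ S)) (weight (length S)) (𝟙 (f ∈? g ∷ S)) ⟩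
    (weight (length S) * card (g ∷ S)) * 𝟙 (f ∈? g ∷ S)      ≡⟨ cong (_* 𝟙 (f ∈? g ∷ S)) (weight-card g S) ⟩
    1ℚ * 𝟙 (f ∈? g ∷ S)                                      ≡⟨ ℚₚ.*-identityˡ _ ⟩
    𝟙 (f ∈? g ∷ S)                                           ∎
    where
    open ≡-Reasoning
    open +-*-Solver

  uniform-∉ : ∀ {S} {f : BoolFun n} → ¬ f ∈ S → uniform S f ≡ 0ℚ
  uniform-∉ {[]}    {f} f∉S = refl
  uniform-∉ {g ∷ S} {f} f∉S = trans (uniform-∷ g S f)
    (trans (cong (weight (length S) *_) (𝟙-no (f ∈? g ∷ S) f∉S)) (ℚₚ.*-zeroʳ (weight (length S))))

  uniform-∈ : ∀ {S} {f : BoolFun n} → f ∈ S → Supp (uniform S) f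
  uniform-∈ {g ∷ S} {f} f∈S = subst (0ℚ <ℚ_)
    (sym (trans (uniform-∷ g S f)
      (trans (cong (weight (length S) *_) (𝟙-yes (f ∈? g ∷ S) f∈S)) (ℚₚ.*-identityʳ (weight (length S))))))
    (0<weight (length S))

  uniform-resp : ∀ S → Respects (uniform {n} S)
  uniform-resp []      f g f≗g = refl
  uniform-resp (h ∷ S) f g f≗g = begin
    uniform (h ∷ S) f                       ≡⟨ uniform-∷ h S f ⟩
    weight (length S) * 𝟙 (f ∈? h ∷ S)      ≡⟨ cong (weight (length S) *_) (𝟙-cong (f ∈? h ∷ S) (g ∈? h ∷ S)
                                                 (∈-resp-≗ f≗g) (∈-resp-≗ (λ v → sym (f≗g v)))) ⟩
    weight (length S) * 𝟙 (g ∈? h ∷ S)      ≡⟨ sym (uniform-∷ h S g) ⟩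
    uniform (h ∷ S) g                       ∎
    where
    open ≡-Reasoning

  ∑-uniform : ∀ {g S} → Unique (g ∷ S) → ∀ F → Respects F →
              ∑ all (λ f → uniform (g ∷ S) f * F f) ≡ weight (length S) * ∑ (g ∷ S) F
  ∑-uniform {g} {S} S! F F-resp = begin
    ∑ all (λ f → uniform (g ∷ S) f * F f)
      ≡⟨ ∑-cong all (λ f → trans (cong (_* F f) (uniform-∷ g S f))
                                 (ℚₚ.*-assoc (weight (length S)) (𝟙 (f ∈? g ∷ S)) (F f))) ⟩
    ∑ all (λ f → weight (length S) * (𝟙 (f ∈? g ∷ S) * F f))
      ≡⟨ ∑-*ˡ all (weight (length S)) (λ f → 𝟙 (f ∈? g ∷ S) * F f) ⟩
    weight (length S) * ∑ all (λ f → 𝟙 (f ∈? g ∷ S) * F f)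
      ≡⟨ cong (weight (length S) *_) (∑-all-∈ S! F F-resp) ⟩
    weight (length S) * ∑ (g ∷ S) F ∎
    where
    open ≡-Reasoning

-- Fourier analysis of the growth process

parity-replicate-even : ∀ k b → k % 2 ≡ 0 → parity (replicate k b) ≡ false
parity-replicate-even zero          b     _  = refl
parity-replicate-even (suc (suc k)) b     ev = trans (sym (𝔹.xor-assoc b b _))
  (trans (cong (_xor parity (replicate k b)) (𝔹.xor-same b)) (parity-replicate-even k b ev))

parity-replicate-odd : ∀ k b → k % 2 ≡ 1 → parity (replicate k b) ≡ b
parity-replicate-odd (suc zero)    b _   = 𝔹.xor-identityʳ b
parity-replicate-odd (suc (suc k)) b odd = trans (sym (𝔹.xor-assoc b b _))
  (trans (cong (_xor parity (replicate k b)) (𝔹.xor-same b)) (parity-replicate-odd k b odd))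

productℚ-* : ∀ {a} {A : Set a} {k} (F G : A → ℚ) (xs : Vec A k) →
             productℚ (Vec.map F xs) * productℚ (Vec.map G xs) ≡ productℚ (Vec.map (λ x → F x * G x) xs)
productℚ-* F G []       = refl
productℚ-* F G (x ∷ xs) = trans
  (solve 4 (λ a b c d → (a :* b) :* (c :* d) := (a :* c) :* (b :* d)) refl
    (F x) (productℚ (Vec.map F xs)) (G x) (productℚ (Vec.map G xs)))
  (cong (F x * G x *_) (productℚ-* F G xs))
  where
  open +-*-Solver

-- The pairing turns the linear connective on functions into the one on bits.
⟨⟩-compose : ∀ {n k} c (T : BoolFun n) (gs : Vec (BoolFun n) k) →
             ⟨ T , compose (linearConnective k c) gs ⟩ ≡ ⟨ T , constant c ⟩ xor parity (Vec.map ⟨ T ,_⟩ gs)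
⟨⟩-compose {n} c T gs = trans (⟨⟩-⊕ʳ T (constant c) (total gs)) (cong (⟨ T , constant c ⟩ xor_) (⟨⟩-total gs))
  where
  total : ∀ {k} → Vec (BoolFun n) k → BoolFun n
  total gs v = parity (Vec.map (λ g → g v) gs)
  ⟨⟩-total : ∀ {k} (gs : Vec (BoolFun n) k) → ⟨ T , total gs ⟩ ≡ parity (Vec.map ⟨ T ,_⟩ gs)
  ⟨⟩-total []       = ⟨⟩-zeroʳ T
  ⟨⟩-total (g ∷ gs) = trans (⟨⟩-⊕ʳ T g (total gs)) (cong (⟨ T , g ⟩ xor_) (⟨⟩-total gs))

sgn-parity : ∀ {a} {A : Set a} {k} (B : A → Bool) (xs : Vec A k) →
             sgn (parity (Vec.map B xs)) ≡ productℚ (Vec.map (sgn ∘ B) xs)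
sgn-parity B []       = refl
sgn-parity B (x ∷ xs) = trans (sgn-xor (B x) (parity (Vec.map B xs))) (cong (sgn (B x) *_) (sgn-parity B xs))

map-const-parity : ∀ {a} {A : Set a} (B : A → Bool) k x → parity (Vec.map B (replicate k x)) ≡ parity (replicate k (B x))
map-const-parity B zero    x = refl
map-const-parity B (suc k) x = cong (B x xor_) (map-const-parity B k x)

char-resp : ∀ {n} (T : BoolFun n) → Respects (char T)
char-resp T f g f≗g = cong sgn (⟨⟩-cong (λ _ → refl) f≗g)

∣char∣ : ∀ {n} (T f : BoolFun n) → ∣ char T f ∣ ≡ 1ℚ
∣char∣ T f = ∣sgn∣ ⟨ T , f ⟩

-- A sum of numbers of absolute value at most one, two of which cancel.
∣∑∣-cancel : ∀ {a} {A : Set a} (xs : List A) (F : A → ℚ) y → (∀ x → ∣ F x ∣ ≤ℚ 1ℚ) →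
             Any (λ x → F x ≡ - y) xs → ∣ y + ∑ xs F ∣ ≤ℚ card xs
∣∑∣-cancel (x ∷ xs) F y F≤1 (here Fx≡-y) = begin
  ∣ y + (F x + ∑ xs F) ∣   ≡⟨ cong (λ z → ∣ y + (z + ∑ xs F) ∣) Fx≡-y ⟩
  ∣ y + (- y + ∑ xs F) ∣   ≡⟨ cong ∣_∣ (solve 2 (λ y s → y :+ (:- y :+ s) := s) refl y (∑ xs F)) ⟩
  ∣ ∑ xs F ∣               ≤⟨ ∣∑∣-bound xs F 1ℚ F≤1 ⟩
  card xs * 1ℚ             ≡⟨ trans (ℚₚ.*-identityʳ (card xs)) (sym (ℚₚ.+-identityˡ (card xs))) ⟩
  0ℚ + card xs             ≤⟨ ℚₚ.+-monoˡ-≤ (card xs) 0≤1 ⟩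
  1ℚ + card xs             ∎
  where
  open ℚₚ.≤-Reasoning
  open +-*-Solver
∣∑∣-cancel (x ∷ xs) F y F≤1 (there p) = begin
  ∣ y + (F x + ∑ xs F) ∣       ≡⟨ cong ∣_∣ (solve 3 (λ y x s → y :+ (x :+ s) := x :+ (y :+ s)) refl y (F x) (∑ xs F)) ⟩
  ∣ F x + (y + ∑ xs F) ∣       ≤⟨ ℚₚ.∣p+q∣≤∣p∣+∣q∣ (F x) (y + ∑ xs F) ⟩
  ∣ F x ∣ + ∣ y + ∑ xs F ∣     ≤⟨ ℚₚ.+-mono-≤ (F≤1 x) (∣∑∣-cancel xs F y F≤1 p) ⟩
  1ℚ + card xs                 ∎
  where
  open ℚₚ.≤-Reasoning
  open +-*-Solver

-- The growth process of a linear connective from any initial weights.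
module Growth {n : ℕ} (k : ℕ) (c : Bool) (μ : Distribution n) (μ-resp : Respects μ) where

  private
    all : List (BoolFun n)
    all = allBoolFuns n

  α : BoolFun k
  α = linearConnective k c

  π : ℕ → Distribution n
  π = growth μ α

  -- The probability of drawing the tuple gs.
  joint : ℕ → Vec (BoolFun n) k → ℚ
  joint i gs = productℚ (Vec.map (π i) gs)

  π-suc : ∀ i f → π (suc i) f ≡ ∑ (vectors all k) (λ gs → 𝟙 (compose α gs ≗? f) * joint i gs)
  π-suc i f = ∑-filter (λ gs → compose α gs ≗? f) (vectors all k) (joint i)

  π-resp : ∀ i → Respects (π i)
  π-resp zero    = μ-resp
  π-resp (suc i) f g f≗g = begin
    π (suc i) f
      ≡⟨ π-suc i f ⟩
    ∑ (vectors all k) (λ gs → 𝟙 (compose α gs ≗? f) * joint i gs)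
      ≡⟨ ∑-cong (vectors all k) (λ gs → cong (_* joint i gs)
           (𝟙-cong (compose α gs ≗? f) (compose α gs ≗? g)
             (λ p v → trans (p v) (f≗g v)) (λ p v → trans (p v) (sym (f≗g v))))) ⟩
    ∑ (vectors all k) (λ gs → 𝟙 (compose α gs ≗? g) * joint i gs)
      ≡⟨ sym (π-suc i g) ⟩
    π (suc i) g ∎
    where
    open ≡-Reasoning

  -- The expectation of F under the i-th distribution.
  𝔼 : ℕ → (BoolFun n → ℚ) → ℚ
  𝔼 i F = ∑ all (λ f → π i f * F f)

  𝔼-suc : ∀ i F → Respects F → 𝔼 (suc i) F ≡ ∑ (vectors all k) (λ gs → joint i gs * F (compose α gs))
  𝔼-suc i F F-resp = begin
    ∑ all (λ f → π (suc i) f * F f)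
      ≡⟨ ∑-cong all (λ f → trans (cong (_* F f) (π-suc i f))
           (sym (∑-*ʳ (vectors all k) (F f) (λ gs → 𝟙 (compose α gs ≗? f) * joint i gs)))) ⟩
    ∑ all (λ f → ∑ (vectors all k) (λ gs → (𝟙 (compose α gs ≗? f) * joint i gs) * F f))
      ≡⟨ ∑-swap all (vectors all k) (λ f gs → (𝟙 (compose α gs ≗? f) * joint i gs) * F f) ⟩
    ∑ (vectors all k) (λ gs → ∑ all (λ f → (𝟙 (compose α gs ≗? f) * joint i gs) * F f))
      ≡⟨ ∑-cong (vectors all k) (λ gs → trans (∑-cong all (regroup gs))
           (∑-*ˡ all (joint i gs) (λ f → 𝟙 (f ≗? compose α gs) * F f))) ⟩
    ∑ (vectors all k) (λ gs → joint i gs * ∑ all (λ f → 𝟙 (f ≗? compose α gs) * F f))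
      ≡⟨ ∑-cong (vectors all k) (λ gs → cong (joint i gs *_) (∑-all-pick F F-resp (compose α gs))) ⟩
    ∑ (vectors all k) (λ gs → joint i gs * F (compose α gs)) ∎
    where
    open ≡-Reasoning
    regroup : ∀ gs f → (𝟙 (compose α gs ≗? f) * joint i gs) * F f ≡ joint i gs * (𝟙 (f ≗? compose α gs) * F f)
    regroup gs f = trans
      (cong (λ z → (z * joint i gs) * F f) (𝟙-cong (compose α gs ≗? f) (f ≗? compose α gs)
        (λ p v → sym (p v)) (λ p v → sym (p v))))
      (solve 3 (λ a b c → (a :* b) :* c := b :* (a :* c)) refl (𝟙 (f ≗? compose α gs)) (joint i gs) (F f))
      where
      open +-*-Solver

  𝔼-char-suc : ∀ i T → 𝔼 (suc i) (char T) ≡ char T (constant c) * 𝔼 i (char T) ^ k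
  𝔼-char-suc i T = begin
    𝔼 (suc i) (char T)
      ≡⟨ 𝔼-suc i (char T) (char-resp T) ⟩
    ∑ (vectors all k) (λ gs → joint i gs * char T (compose α gs))
      ≡⟨ ∑-cong (vectors all k) term ⟩
    ∑ (vectors all k) (λ gs → char T (constant c) * productℚ (Vec.map (λ g → π i g * char T g) gs))
      ≡⟨ ∑-*ˡ (vectors all k) (char T (constant c)) (λ gs → productℚ (Vec.map (λ g → π i g * char T g) gs)) ⟩
    char T (constant c) * ∑ (vectors all k) (λ gs → productℚ (Vec.map (λ g → π i g * char T g) gs))
      ≡⟨ cong (char T (constant c) *_) (∑-vectors all k (λ g → π i g * char T g)) ⟩
    char T (constant c) * 𝔼 i (char T) ^ k ∎
    where
    open ≡-Reasoning
    term : ∀ gs → joint i gs * char T (compose α gs)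
                ≡ char T (constant c) * productℚ (Vec.map (λ g → π i g * char T g) gs)
    term gs = begin
      joint i gs * char T (compose α gs)
        ≡⟨ cong (λ b → joint i gs * sgn b) (⟨⟩-compose c T gs) ⟩
      joint i gs * sgn (⟨ T , constant c ⟩ xor parity (Vec.map ⟨ T ,_⟩ gs))
        ≡⟨ cong (joint i gs *_) (trans (sgn-xor ⟨ T , constant c ⟩ (parity (Vec.map ⟨ T ,_⟩ gs)))
             (cong (char T (constant c) *_) (sgn-parity ⟨ T ,_⟩ gs))) ⟩
      joint i gs * (char T (constant c) * productℚ (Vec.map (char T) gs))
        ≡⟨ solve 3 (λ a b c → a :* (b :* c) := b :* (a :* c)) refl
             (joint i gs) (char T (constant c)) (productℚ (Vec.map (char T) gs)) ⟩
      char T (constant c) * (joint i gs * productℚ (Vec.map (char T) gs))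
        ≡⟨ cong (char T (constant c) *_) (productℚ-* (π i) (char T) gs) ⟩
      char T (constant c) * productℚ (Vec.map (λ g → π i g * char T g) gs) ∎
      where
      open +-*-Solver

-- The growth process started from the uniform distribution on a nonempty list
-- without repetitions.
module Limits {n : ℕ} (k : ℕ) (1<k : 1 < k) (c : Bool) (l₀ : BoolFun n) (L : List (BoolFun n))
  (L! : Unique (l₀ ∷ L)) where

  open Growth k c (uniform (l₀ ∷ L)) (uniform-resp (l₀ ∷ L)) public

  private
    all : List (BoolFun n)
    all = allBoolFuns n

  -- The character of T is constant on the initial functions.
  Balanced : BoolFun n → Set
  Balanced T = All (λ l → ⟨ T , l ⟩ ≡ ⟨ T , l₀ ⟩) L

  Balanced? : Decidable Balanced
  Balanced? T = All.all? (λ l → ⟨ T , l ⟩ 𝔹.≟ ⟨ T , l₀ ⟩) L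

  Balanced-resp : ∀ {S T} → S ≗ T → Balanced S → Balanced T
  Balanced-resp S≗T = All.map λ eq →
    trans (sym (⟨⟩-cong S≗T (λ _ → refl))) (trans eq (⟨⟩-cong S≗T (λ _ → refl)))

  Balanced-⊕ : ∀ {S T} → Balanced S → Balanced T → Balanced (S ⊕ T)
  Balanced-⊕ {S} {T} S-bal T-bal = All.zipWith
    (λ {l} (p , q) → trans (⟨⟩-⊕ˡ S T l) (trans (cong₂ _xor_ p q) (sym (⟨⟩-⊕ˡ S T l₀))))
    (S-bal , T-bal)

  Balanced-zero : Balanced (constant false)
  Balanced-zero = All.universal (λ l → trans (⟨⟩-zeroˡ l) (sym (⟨⟩-zeroˡ l₀))) L

  open Annihilator Balanced Balanced? Balanced-resp (λ {S} {T} → Balanced-⊕ {S} {T})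

  -- Agreement with s under all balanced characters, that is, f + s lies in the
  -- annihilator of the balanced functions.
  Coset : BoolFun n → BoolFun n → Set
  Coset s f = ∀ T → Balanced T → ⟨ T , f ⟩ ≡ ⟨ T , s ⟩

  P⊥⇒Coset : ∀ s f → P⊥ (f ⊕ s) → Coset s f
  P⊥⇒Coset s f h T T-bal = xor≡false⇒≡ _ _ (trans (sym (⟨⟩-⊕ʳ T f s)) (h T T-bal))

  Coset⇒P⊥ : ∀ s f → Coset s f → P⊥ (f ⊕ s)
  Coset⇒P⊥ s f h T T-bal = trans (⟨⟩-⊕ʳ T f s)
    (trans (cong (_xor ⟨ T , s ⟩) (h T T-bal)) (𝔹.xor-same ⟨ T , s ⟩))

  Coset? : ∀ s → Decidable (Coset s)
  Coset? s f = map′ (P⊥⇒Coset s f) (Coset⇒P⊥ s f) (P⊥? (f ⊕ s))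

  Coset-resp : ∀ {s f g} → f ≗ g → Coset s f → Coset s g
  Coset-resp f≗g h T T-bal = trans (sym (⟨⟩-cong (λ _ → refl) f≗g)) (h T T-bal)

  coset : BoolFun n → List (BoolFun n)
  coset s = filter (Coset? s) all

  coset-unique : ∀ s → Unique (coset s)
  coset-unique s = Uniqueₚ.filter⁺ (BoolFunSetoid n) (Coset? s) (allBoolFuns-unique n)

  ∈-coset⁺ : ∀ {s f} → Coset s f → f ∈ coset s
  ∈-coset⁺ {s} {f} h = ∈ₚ.∈-filter⁺ (BoolFunSetoid n) (Coset? s) (λ {f} {g} → Coset-resp {s} {f} {g})
    (allBoolFuns-complete f) h

  ∈-coset⁻ : ∀ {s f} → f ∈ coset s → Coset s f
  ∈-coset⁻ {s} h = proj₂ (∈ₚ.∈-filter⁻ (BoolFunSetoid n) (Coset? s) (λ {f} {g} → Coset-resp {s} {f} {g}) {xs = all} h)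

  coset-cong : ∀ {s t} → Coset s t → coset s ≡ coset t
  coset-cong {s} {t} s∼t = Listₚ.filter-≐ (Coset? s) (Coset? t)
    ( (λ h T T-bal → trans (h T T-bal) (sym (s∼t T T-bal)))
    , (λ h T T-bal → trans (h T T-bal) (s∼t T T-bal)) ) all

  -- Poisson summation for a coset, in multiplied-out form.
  order*𝟙 : ∀ s f → order * 𝟙 (Coset? s f) ≡ ∑ all (λ T → 𝟙 (Balanced? T) * char T (f ⊕ s))
  order*𝟙 s f = trans (ℚₚ.*-comm order (𝟙 (Coset? s f))) (sym (∑-characters (f ⊕ s)))

  -- Lagrange's theorem for the annihilator: summing the previous identity over
  -- all f, only T = 0 contributes on the right.
  order*card-coset : ∀ s → order * card (coset s) ≡ card all
  order*card-coset s = begin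
    order * card (coset s)
      ≡⟨ cong (order *_) (∑-filter (Coset? s) all (λ _ → 1ℚ)) ⟩
    order * ∑ all (λ f → 𝟙 (Coset? s f) * 1ℚ)
      ≡⟨ sym (∑-*ˡ all order (λ f → 𝟙 (Coset? s f) * 1ℚ)) ⟩
    ∑ all (λ f → order * (𝟙 (Coset? s f) * 1ℚ))
      ≡⟨ ∑-cong all (λ f → trans (cong (order *_) (ℚₚ.*-identityʳ (𝟙 (Coset? s f)))) (order*𝟙 s f)) ⟩
    ∑ all (λ f → ∑ all (λ T → 𝟙 (Balanced? T) * char T (f ⊕ s)))
      ≡⟨ ∑-swap all all (λ f T → 𝟙 (Balanced? T) * char T (f ⊕ s)) ⟩
    ∑ all (λ T → ∑ all (λ f → 𝟙 (Balanced? T) * char T (f ⊕ s)))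
      ≡⟨ ∑-cong all (λ T → trans (∑-*ˡ all (𝟙 (Balanced? T)) (λ f → char T (f ⊕ s)))
           (cong (𝟙 (Balanced? T) *_) (trans (∑-translate (char T) (char-resp T) s) (∑-all-charactersʳ T)))) ⟩
    ∑ all (λ T → 𝟙 (Balanced? T) * (𝟙 (T ≗? constant false) * card all))
      ≡⟨ ∑-cong all (λ T → solve 3 (λ a b c → a :* (b :* c) := b :* a :* c) refl
           (𝟙 (Balanced? T)) (𝟙 (T ≗? constant false)) (card all)) ⟩
    ∑ all (λ T → 𝟙 (T ≗? constant false) * 𝟙 (Balanced? T) * card all)
      ≡⟨ ∑-*ʳ all (card all) (λ T → 𝟙 (T ≗? constant false) * 𝟙 (Balanced? T)) ⟩
    ∑ all (λ T → 𝟙 (T ≗? constant false) * 𝟙 (Balanced? T)) * card all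
      ≡⟨ cong (_* card all) (∑-all-pick (𝟙 ∘ Balanced?) 𝟙-resp (constant false)) ⟩
    𝟙 (Balanced? (constant false)) * card all
      ≡⟨ cong (_* card all) (𝟙-yes (Balanced? (constant false)) Balanced-zero) ⟩
    1ℚ * card all
      ≡⟨ ℚₚ.*-identityˡ (card all) ⟩
    card all ∎
    where
    open ≡-Reasoning
    open +-*-Solver

  card*uniform-coset : ∀ s f → card all * uniform (coset s) f
                             ≡ ∑ all (λ T → 𝟙 (Balanced? T) * char T s * char T f)
  card*uniform-coset s f = begin
    card all * uniform (coset s) f
      ≡⟨ cong (_* uniform (coset s) f) (sym (order*card-coset s)) ⟩
    order * card (coset s) * uniform (coset s) f
      ≡⟨ ℚₚ.*-assoc order (card (coset s)) (uniform (coset s) f) ⟩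
    order * (card (coset s) * uniform (coset s) f)
      ≡⟨ cong (order *_) (uniform-card (coset s) f) ⟩
    order * 𝟙 (f ∈? coset s)
      ≡⟨ cong (order *_) (𝟙-cong (f ∈? coset s) (Coset? s f) ∈-coset⁻ ∈-coset⁺) ⟩
    order * 𝟙 (Coset? s f)
      ≡⟨ order*𝟙 s f ⟩
    ∑ all (λ T → 𝟙 (Balanced? T) * char T (f ⊕ s))
      ≡⟨ ∑-cong all (λ T → trans
           (cong (𝟙 (Balanced? T) *_) (trans (cong sgn (⟨⟩-⊕ʳ T f s)) (sgn-xor ⟨ T , f ⟩ ⟨ T , s ⟩)))
           (solve 3 (λ a b c → a :* (b :* c) := a :* c :* b) refl (𝟙 (Balanced? T)) (char T f) (char T s))) ⟩
    ∑ all (λ T → 𝟙 (Balanced? T) * char T s * char T f) ∎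
    where
    open ≡-Reasoning
    open +-*-Solver

  0<card-all : 0ℚ <ℚ card all
  0<card-all = nonempty (allBoolFuns-complete (constant false))
    where
    nonempty : ∀ {f : BoolFun n} {xs} → f ∈ xs → 0ℚ <ℚ card xs
    nonempty {xs = x ∷ xs} _ = ℚₚ.+-mono-<-≤ (ℚₚ.positive⁻¹ 1ℚ) (card-nonneg xs)

  0<order : 0ℚ <ℚ order
  0<order with ℚₚ.<-cmp 0ℚ order
  ... | tri< 0<o _ _ = 0<o
  ... | tri≈ _ 0≡o _ = ⊥-elim (ℚₚ.<-irrefl (trans (sym (ℚₚ.*-zeroˡ (card (coset l₀))))
                         (trans (cong (_* card (coset l₀)) 0≡o) (order*card-coset l₀))) 0<card-all)
  ... | tri> _ _ o<0 = ⊥-elim (ℚₚ.<-irrefl refl (ℚₚ.<-≤-trans 0<card-all (begin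
      card all                 ≡⟨ sym (order*card-coset l₀) ⟩
      order * card (coset l₀)  ≤⟨ ℚₚ.*-monoʳ-≤-nonNeg (card (coset l₀))
                                    {{ℚ.nonNegative (card-nonneg (coset l₀))}} (ℚₚ.<⇒≤ o<0) ⟩
      0ℚ * card (coset l₀)     ≡⟨ ℚₚ.*-zeroˡ (card (coset l₀)) ⟩
      0ℚ                       ∎)))
    where
    open ℚₚ.≤-Reasoning

  length-coset : ∀ s t → length (coset s) ≡ length (coset t)
  length-coset s t = fromℕ-injective (trans (sym (card-length (coset s)))
    (trans (*-cancelˡ (trans (order*card-coset s) (sym (order*card-coset t)))) (card-length (coset t))))
    where
    instance
      order-pos = ℚ.positive 0<order
    *-cancelˡ : ∀ {x y} → order * x ≡ order * y → x ≡ y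
    *-cancelˡ eq = ℚₚ.≤-antisym (ℚₚ.*-cancelˡ-≤-pos order (ℚₚ.≤-reflexive eq))
                                (ℚₚ.*-cancelˡ-≤-pos order (ℚₚ.≤-reflexive (sym eq)))

  -- The functions grown from l₀ alone.
  seed : ℕ → BoolFun n
  seed zero    = l₀
  seed (suc i) = compose α (replicate k (seed i))

  ⟨⟩-seed-suc : ∀ i T → ⟨ T , seed (suc i) ⟩ ≡ ⟨ T , constant c ⟩ xor parity (replicate k ⟨ T , seed i ⟩)
  ⟨⟩-seed-suc i T = trans (⟨⟩-compose c T (replicate k (seed i)))
    (cong (⟨ T , constant c ⟩ xor_) (map-const-parity ⟨ T ,_⟩ k (seed i)))

  -- The weight w of a single initial function, and 1 - w: a character that is
  -- not constant on the initial functions loses at least one unit to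
  -- cancellation, so its mean is at most ρ in absolute value.
  w ρ : ℚ
  w = weight (length L)
  ρ = w * card L

  0≤ρ : 0ℚ ≤ℚ ρ
  0≤ρ = 0≤* (ℚₚ.<⇒≤ (0<weight (length L))) (card-nonneg L)

  w+ρ≡1 : w + ρ ≡ 1ℚ
  w+ρ≡1 = trans (solve 2 (λ w m → w :+ w :* m := w :* (con 1ℚ :+ m)) refl w (card L)) (weight-card l₀ L)
    where
    open +-*-Solver

  open Decay 0≤ρ (0<weight (length L)) w+ρ≡1

  𝔼-zero : ∀ T → 𝔼 0 (char T) ≡ w * ∑ (l₀ ∷ L) (char T)
  𝔼-zero T = ∑-uniform L! (char T) (char-resp T)

  𝔼-balanced : ∀ i T → Balanced T → 𝔼 i (char T) ≡ char T (seed i)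
  𝔼-balanced zero T T-bal = begin
    𝔼 0 (char T)                              ≡⟨ 𝔼-zero T ⟩
    w * (char T l₀ + ∑ L (char T))            ≡⟨ cong (λ z → w * (char T l₀ + z)) (constant-sum T-bal) ⟩
    w * (char T l₀ + card L * char T l₀)      ≡⟨ solve 3 (λ w x m → w :* (x :+ m :* x) := (w :+ w :* m) :* x) refl w (char T l₀) (card L) ⟩
    (w + ρ) * char T l₀                       ≡⟨ cong (_* char T l₀) w+ρ≡1 ⟩
    1ℚ * char T l₀                            ≡⟨ ℚₚ.*-identityˡ (char T l₀) ⟩
    char T l₀                                 ∎
    where
    open ≡-Reasoning
    open +-*-Solver
    constant-sum : ∀ {xs} → All (λ l → ⟨ T , l ⟩ ≡ ⟨ T , l₀ ⟩) xs → ∑ xs (char T) ≡ card xs * char T l₀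
    constant-sum []                = sym (ℚₚ.*-zeroˡ (char T l₀))
    constant-sum {x ∷ xs} (p ∷ ps) = trans (cong₂ _+_ (cong sgn p) (constant-sum ps))
      (solve 2 (λ x m → x :+ m :* x := (con 1ℚ :+ m) :* x) refl (char T l₀) (card xs))
  𝔼-balanced (suc i) T T-bal = begin
    𝔼 (suc i) (char T)                                             ≡⟨ 𝔼-char-suc i T ⟩
    char T (constant c) * 𝔼 i (char T) ^ k                         ≡⟨ cong (λ z → char T (constant c) * z ^ k) (𝔼-balanced i T T-bal) ⟩
    char T (constant c) * char T (seed i) ^ k                      ≡⟨ cong (char T (constant c) *_) (sym (sgn-replicate k)) ⟩
    char T (constant c) * sgn (parity (replicate k ⟨ T , seed i ⟩))  ≡⟨ sym (sgn-xor ⟨ T , constant c ⟩ _) ⟩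
    sgn (⟨ T , constant c ⟩ xor parity (replicate k ⟨ T , seed i ⟩)) ≡⟨ cong sgn (sym (⟨⟩-seed-suc i T)) ⟩
    char T (seed (suc i))                                          ∎
    where
    open ≡-Reasoning
    sgn-replicate : ∀ j → sgn (parity (replicate j ⟨ T , seed i ⟩)) ≡ char T (seed i) ^ j
    sgn-replicate zero    = refl
    sgn-replicate (suc j) = trans (sgn-xor ⟨ T , seed i ⟩ (parity (replicate j ⟨ T , seed i ⟩)))
                                  (cong (char T (seed i) *_) (sgn-replicate j))

  𝔼-unbalanced : ∀ i T → ¬ Balanced T → ∣ 𝔼 i (char T) ∣ ≤ℚ ρ ^ suc i
  𝔼-unbalanced zero T T-unbal = begin
    ∣ 𝔼 0 (char T) ∣                          ≡⟨ cong ∣_∣ (𝔼-zero T) ⟩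
    ∣ w * (char T l₀ + ∑ L (char T)) ∣        ≡⟨ ℚₚ.∣p*q∣≡∣p∣*∣q∣ w _ ⟩
    ∣ w ∣ * ∣ char T l₀ + ∑ L (char T) ∣      ≡⟨ cong (_* ∣ char T l₀ + ∑ L (char T) ∣) (ℚₚ.0≤p⇒∣p∣≡p 0≤w) ⟩
    w * ∣ char T l₀ + ∑ L (char T) ∣          ≤⟨ ℚₚ.*-monoˡ-≤-nonNeg w {{ℚ.nonNegative 0≤w}}
                                                   (∣∑∣-cancel L (char T) (char T l₀) (λ f → ℚₚ.≤-reflexive (∣char∣ T f)) opposite) ⟩
    w * card L                                ≡⟨ sym (ℚₚ.*-identityʳ ρ) ⟩
    ρ * 1ℚ                                    ∎
    where
    open ℚₚ.≤-Reasoning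
    0≤w : 0ℚ ≤ℚ w
    0≤w = ℚₚ.<⇒≤ (0<weight (length L))
    opposite : Any (λ l → char T l ≡ - char T l₀) L
    opposite = Any.map (λ {l} l≢l₀ → trans (cong sgn (𝔹.¬-not l≢l₀)) (sgn-not ⟨ T , l₀ ⟩))
      (Allₚ.¬All⇒Any¬ (λ l → ⟨ T , l ⟩ 𝔹.≟ ⟨ T , l₀ ⟩) L T-unbal)
  𝔼-unbalanced (suc i) T T-unbal = begin
    ∣ 𝔼 (suc i) (char T) ∣                       ≡⟨ cong ∣_∣ (𝔼-char-suc i T) ⟩
    ∣ char T (constant c) * x ^ k ∣              ≡⟨ ℚₚ.∣p*q∣≡∣p∣*∣q∣ (char T (constant c)) (x ^ k) ⟩
    ∣ char T (constant c) ∣ * ∣ x ^ k ∣          ≡⟨ cong (_* ∣ x ^ k ∣) (∣char∣ T (constant c)) ⟩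
    1ℚ * ∣ x ^ k ∣                               ≡⟨ ℚₚ.*-identityˡ ∣ x ^ k ∣ ⟩
    ∣ x ^ k ∣                                    ≤⟨ power 1<k ⟩
    ρ ^ suc (suc i)                              ∎
    where
    open ℚₚ.≤-Reasoning
    x : ℚ
    x = 𝔼 i (char T)
    ∣x∣≤ρ^ : ∣ x ∣ ≤ℚ ρ ^ suc i
    ∣x∣≤ρ^ = 𝔼-unbalanced i T T-unbal
    ρ^≤ρ : ρ ^ suc i ≤ℚ ρ
    ρ^≤ρ = begin
      ρ * ρ ^ i     ≤⟨ ℚₚ.*-monoˡ-≤-nonNeg ρ {{ℚ.nonNegative 0≤ρ}}
                      (subst (λ j → ρ ^ j ≤ℚ 1ℚ) (ℕₚ.+-identityʳ i) (^-antimono 0 i)) ⟩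
      ρ * 1ℚ        ≡⟨ ℚₚ.*-identityʳ ρ ⟩
      ρ             ∎
    ∣x∣≤ρ : ∣ x ∣ ≤ℚ ρ
    ∣x∣≤ρ = ℚₚ.≤-trans ∣x∣≤ρ^ ρ^≤ρ
    power : ∀ {k} → 1 < k → ∣ x ^ k ∣ ≤ℚ ρ ^ suc (suc i)
    power {suc (suc j)} (s≤s (s≤s _)) = begin
      ∣ x * (x * x ^ j) ∣           ≡⟨ trans (ℚₚ.∣p*q∣≡∣p∣*∣q∣ x (x * x ^ j)) (cong (∣ x ∣ *_) (ℚₚ.∣p*q∣≡∣p∣*∣q∣ x (x ^ j))) ⟩
      ∣ x ∣ * (∣ x ∣ * ∣ x ^ j ∣)   ≤⟨ *-mono-≤ ∣x∣≤ρ 0≤ρ (0≤* (ℚₚ.0≤∣p∣ x) (ℚₚ.0≤∣p∣ (x ^ j)))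
                                        (*-mono-≤ ∣x∣≤ρ^ (0≤^ 0≤ρ (suc i)) (ℚₚ.0≤∣p∣ (x ^ j)) (∣^∣≤1 x (ℚₚ.≤-trans ∣x∣≤ρ ρ≤1) j)) ⟩
      ρ * (ρ ^ suc i * 1ℚ)          ≡⟨ cong (ρ *_) (ℚₚ.*-identityʳ (ρ ^ suc i)) ⟩
      ρ * ρ ^ suc i                 ∎

  -- The difference is expanded by Fourier inversion; each of its card all
  -- coefficients is at most ρ ^ suc i in absolute value.
  approximation : ∀ i f → ∣ π i f - uniform (coset (seed i)) f ∣ ≤ℚ ρ ^ suc i
  approximation i f = ℚₚ.*-cancelˡ-≤-pos (card all) (begin
    card all * ∣ d ∣                           ≡⟨ cong (_* ∣ d ∣) (sym (ℚₚ.0≤p⇒∣p∣≡p (card-nonneg all))) ⟩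
    ∣ card all ∣ * ∣ d ∣                       ≡⟨ sym (ℚₚ.∣p*q∣≡∣p∣*∣q∣ (card all) d) ⟩
    ∣ card all * d ∣                           ≡⟨ cong ∣_∣ transform ⟩
    ∣ ∑ all (λ T → error T * char T f) ∣       ≤⟨ ∣∑∣-bound all _ (ρ ^ suc i) bound ⟩
    card all * ρ ^ suc i                       ∎)
    where
    open ℚₚ.≤-Reasoning
    open +-*-Solver
    instance
      card-pos = ℚ.positive 0<card-all
    u d : ℚ
    u = uniform (coset (seed i)) f
    d = π i f - u
    error : BoolFun n → ℚ
    error T = 𝔼 i (char T) - 𝟙 (Balanced? T) * char T (seed i)
    main : BoolFun n → ℚ
    main T = 𝟙 (Balanced? T) * char T (seed i) * char T f
    transform : card all * d ≡ ∑ all (λ T → error T * char T f)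
    transform = begin-equality
      card all * (π i f - u)
        ≡⟨ solve 3 (λ m x y → m :* (x :- y) := m :* x :+ :- (m :* y)) refl (card all) (π i f) u ⟩
      card all * π i f + - (card all * u)
        ≡⟨ cong₂ _+_ (sym (∑-inversion (π i) (π-resp i) f)) (cong -_ (card*uniform-coset (seed i) f)) ⟩
      ∑ all (λ T → 𝔼 i (char T) * char T f) + - ∑ all main
        ≡⟨ cong (∑ all (λ T → 𝔼 i (char T) * char T f) +_) (sym (∑-neg all main)) ⟩
      ∑ all (λ T → 𝔼 i (char T) * char T f) + ∑ all (λ T → - main T)
        ≡⟨ sym (∑-+ all (λ T → 𝔼 i (char T) * char T f) (λ T → - main T)) ⟩
      ∑ all (λ T → 𝔼 i (char T) * char T f + - main T)
        ≡⟨ ∑-cong all (λ T → solve 3 (λ e b x → e :* x :+ :- (b :* x) := (e :- b) :* x) refl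
             (𝔼 i (char T)) (𝟙 (Balanced? T) * char T (seed i)) (char T f)) ⟩
      ∑ all (λ T → error T * char T f) ∎
    error-bound : ∀ T (b : Dec (Balanced T)) → ∣ 𝔼 i (char T) - 𝟙 b * char T (seed i) ∣ ≤ℚ ρ ^ suc i
    error-bound T (yes T-bal) = begin
      ∣ 𝔼 i (char T) - 1ℚ * char T (seed i) ∣    ≡⟨ cong (λ z → ∣ z - 1ℚ * char T (seed i) ∣) (𝔼-balanced i T T-bal) ⟩
      ∣ char T (seed i) - 1ℚ * char T (seed i) ∣ ≡⟨ cong ∣_∣ (solve 1 (λ x → x :- con 1ℚ :* x := con 0ℚ) refl (char T (seed i))) ⟩
      0ℚ                                         ≤⟨ 0≤^ 0≤ρ (suc i) ⟩
      ρ ^ suc i                                  ∎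
    error-bound T (no T-unbal) = begin
      ∣ 𝔼 i (char T) - 0ℚ * char T (seed i) ∣    ≡⟨ cong ∣_∣ (solve 2 (λ e x → e :- con 0ℚ :* x := e) refl (𝔼 i (char T)) (char T (seed i))) ⟩
      ∣ 𝔼 i (char T) ∣                           ≤⟨ 𝔼-unbalanced i T T-unbal ⟩
      ρ ^ suc i                                  ∎
    bound : ∀ T → ∣ error T * char T f ∣ ≤ℚ ρ ^ suc i
    bound T = begin
      ∣ error T * char T f ∣        ≡⟨ ℚₚ.∣p*q∣≡∣p∣*∣q∣ (error T) (char T f) ⟩
      ∣ error T ∣ * ∣ char T f ∣    ≡⟨ trans (cong (∣ error T ∣ *_) (∣char∣ T f)) (ℚₚ.*-identityʳ ∣ error T ∣) ⟩
      ∣ error T ∣                   ≤⟨ error-bound T (Balanced? T) ⟩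
      ρ ^ suc i                     ∎

  convergence : ∀ f ε → 0ℚ <ℚ ε → ∃ λ N → ∀ i → N ≤ i → ∣ π i f - uniform (coset (seed i)) f ∣ <ℚ ε
  convergence f ε 0<ε = proj₁ tail , λ i N≤i →
    ℚₚ.≤-<-trans (approximation i f) (proj₂ tail (suc i) (ℕₚ.m≤n⇒m≤1+n N≤i))
    where
    tail : ∃ λ N → ∀ i → N ≤ i → ρ ^ i <ℚ ε
    tail = decay ε 0<ε

  -- Supports

  ∈-initial⇒ : ∀ {f} T → Balanced T → f ∈ l₀ ∷ L → ⟨ T , f ⟩ ≡ ⟨ T , l₀ ⟩
  ∈-initial⇒ T T-bal (here f≗l₀)  = ⟨⟩-cong (λ _ → refl) f≗l₀
  ∈-initial⇒ T T-bal (there f∈L)  =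
    All.lookupWith (λ eq f≗l → trans (⟨⟩-cong (λ _ → refl) f≗l) eq) T-bal f∈L

  -- Every tuple composing to a function outside the coset of seed (suc i) has a
  -- component outside the coset of seed i, so it has probability zero.
  vanishes-off-coset : ∀ i f → ¬ Coset (seed i) f → π i f ≡ 0ℚ
  vanishes-off-coset zero    f f∉ = uniform-∉ (λ f∈ → f∉ (λ T T-bal → ∈-initial⇒ T T-bal f∈))
  vanishes-off-coset (suc i) f f∉ = trans (π-suc i f)
    (trans (∑-cong (vectors all k) (λ gs → term gs (compose α gs ≗? f))) (∑-zero (vectors all k)))
    where
    zero-or-coset : ∀ {j} (gs : Vec (BoolFun n) j) → productℚ (Vec.map (π i) gs) ≡ 0ℚ
      ⊎ (∀ T → Balanced T → parity (Vec.map ⟨ T ,_⟩ gs) ≡ parity (replicate j ⟨ T , seed i ⟩))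
    zero-or-coset []       = inj₂ (λ _ _ → refl)
    zero-or-coset (g ∷ gs) with Coset? (seed i) g | zero-or-coset gs
    ... | no g∉    | _         = inj₁ (trans (cong (_* _) (vanishes-off-coset i g g∉)) (ℚₚ.*-zeroˡ (productℚ (Vec.map (π i) gs))))
    ... | yes g∈   | inj₁ eq   = inj₁ (trans (cong (π i g *_) eq) (ℚₚ.*-zeroʳ (π i g)))
    ... | yes g∈   | inj₂ h    = inj₂ (λ T T-bal → cong₂ _xor_ (g∈ T T-bal) (h T T-bal))

    term : ∀ gs (d : Dec (compose α gs ≗ f)) → 𝟙 d * joint i gs ≡ 0ℚ
    term gs (no  _)    = ℚₚ.*-zeroˡ (joint i gs)
    term gs (yes gs≗f) with zero-or-coset gs
    ... | inj₁ eq = trans (cong (1ℚ *_) eq) (ℚₚ.*-zeroʳ 1ℚ)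
    ... | inj₂ h  = ⊥-elim (f∉ λ T T-bal → begin
      ⟨ T , f ⟩                                                    ≡⟨ sym (⟨⟩-cong (λ _ → refl) gs≗f) ⟩
      ⟨ T , compose α gs ⟩                                         ≡⟨ ⟨⟩-compose c T gs ⟩
      ⟨ T , constant c ⟩ xor parity (Vec.map ⟨ T ,_⟩ gs)           ≡⟨ cong (⟨ T , constant c ⟩ xor_) (h T T-bal) ⟩
      ⟨ T , constant c ⟩ xor parity (replicate k ⟨ T , seed i ⟩)   ≡⟨ sym (⟨⟩-seed-suc i T) ⟩
      ⟨ T , seed (suc i) ⟩                                         ∎)
      where
      open ≡-Reasoning

  Supp⇒Coset : ∀ i f → Supp (π i) f → Coset (seed i) f
  Supp⇒Coset i f 0<πf with Coset? (seed i) f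
  ... | yes f∈ = f∈
  ... | no  f∉ = ⊥-elim (ℚₚ.<-irrefl (sym (vanishes-off-coset i f f∉)) 0<πf)

  positive-near : ∀ {p u} → 0ℚ <ℚ u → ∣ p - u ∣ <ℚ u → 0ℚ <ℚ p
  positive-near {p} {u} 0<u d<u with ℚₚ.∣p∣≡p∨∣p∣≡-p (p - u)
  ... | inj₁ eq = subst (0ℚ <ℚ_) (solve 2 (λ p u → u :+ (p :- u) := p) refl p u)
                    (ℚₚ.+-mono-<-≤ 0<u (ℚₚ.∣p∣≡p⇒0≤p eq))
    where
    open +-*-Solver
  ... | inj₂ eq = subst₂ _<ℚ_ (ℚₚ.+-inverseˡ (p - u)) (solve 2 (λ p u → u :+ (p :- u) := p) refl p u)
                    (ℚₚ.+-monoˡ-< (p - u) (subst (_<ℚ u) eq d<u))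
    where
    open +-*-Solver

  -- A coset visited infinitely often lies in the support: along the visits the
  -- weight of f tends to its uniform weight, which is positive.
  recurrent⇒ProcessSupp : ∀ s → (∀ N → ∃ λ i → N ≤ i × 0 < i × coset (seed i) ≡ coset s) →
                          ∀ f → Coset s f → ProcessSupp π f
  recurrent⇒ProcessSupp s recurrent f f∈ =
    let 0<u                     = uniform-∈ (∈-coset⁺ {s} f∈)
        N , close               = convergence f (uniform (coset s) f) 0<u
        i , N≤i , 0<i , same    = recurrent N
    in i , 0<i , positive-near 0<u
         (subst (λ S → ∣ π i f - uniform S f ∣ <ℚ uniform (coset s) f) same (close i N≤i))

  -- The hypothesis starts at index 1, because l₀ may lie in another coset.
  stationary : (∀ i T → Balanced T → ⟨ T , seed (suc (suc i)) ⟩ ≡ ⟨ T , seed (suc i) ⟩) →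
               ∃[ S ] S Enumerates ProcessSupp π × (π ⟶ uniform S)
  stationary step = coset (seed 1) , (coset-unique (seed 1) , λ f → mk⇔ to (from f)) , limit
    where
    seed≡ : ∀ i T → Balanced T → ⟨ T , seed (suc i) ⟩ ≡ ⟨ T , seed 1 ⟩
    seed≡ zero    T T-bal = refl
    seed≡ (suc i) T T-bal = trans (step i T T-bal) (seed≡ i T T-bal)
    same : ∀ i → coset (seed (suc i)) ≡ coset (seed 1)
    same i = sym (coset-cong {seed 1} {seed (suc i)} (seed≡ i))
    to : ∀ {f} → f ∈ coset (seed 1) → ProcessSupp π f
    to {f} f∈ = recurrent⇒ProcessSupp (seed 1) (λ N → suc N , ℕₚ.n≤1+n N , s≤s z≤n , same N) f
                  (∈-coset⁻ {seed 1} f∈)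
    from : ∀ f → ProcessSupp π f → f ∈ coset (seed 1)
    from f (suc i , _ , 0<πf) = subst (f ∈_) (same i) (∈-coset⁺ {seed (suc i)} (Supp⇒Coset (suc i) f 0<πf))
    limit : π ⟶ uniform (coset (seed 1))
    limit f ε 0<ε = suc (proj₁ near) , λ where
        (suc i) (s≤s N≤i) → subst (λ S → ∣ π (suc i) f - uniform S f ∣ <ℚ ε) (same i)
                              (proj₂ near (suc i) (ℕₚ.m≤n⇒m≤1+n N≤i))
      where near = convergence f ε 0<ε

  -- The representative of the cosets at odd times, when every step adds 1.
  l₁ : BoolFun n
  l₁ = constant true ⊕ l₀

  -- The case where each step adds the constant 1, and some balanced T₁ detects it.
  module Alternating
    (step : ∀ i T → ⟨ T , seed (suc i) ⟩ ≡ ⟨ T , constant true ⟩ xor ⟨ T , seed i ⟩)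
    (T₁ : BoolFun n) (T₁-balanced : Balanced T₁) (T₁-separates : ⟨ T₁ , constant true ⟩ ≡ true) where

    H₀ H₁ S : List (BoolFun n)
    H₀ = coset l₀
    H₁ = coset l₁
    S  = H₀ ++ H₁

    ⟨⟩-l₁ : ∀ T → ⟨ T , l₁ ⟩ ≡ ⟨ T , constant true ⟩ xor ⟨ T , l₀ ⟩
    ⟨⟩-l₁ T = ⟨⟩-⊕ʳ T (constant true) l₀

    seed-even : ∀ i T → ⟨ T , seed (2 ℕ.* i) ⟩ ≡ ⟨ T , l₀ ⟩
    seed-even zero    T = refl
    seed-even (suc i) T = begin
      ⟨ T , seed (2 ℕ.* suc i) ⟩                  ≡⟨ cong (λ j → ⟨ T , seed j ⟩) (ℕₚ.*-suc 2 i) ⟩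
      ⟨ T , seed (2 ℕ.+ 2 ℕ.* i) ⟩                ≡⟨ step (suc (2 ℕ.* i)) T ⟩
      t xor ⟨ T , seed (suc (2 ℕ.* i)) ⟩          ≡⟨ cong (t xor_) (step (2 ℕ.* i) T) ⟩
      t xor (t xor ⟨ T , seed (2 ℕ.* i) ⟩)        ≡⟨ sym (𝔹.xor-assoc t t _) ⟩
      (t xor t) xor ⟨ T , seed (2 ℕ.* i) ⟩        ≡⟨ cong (_xor ⟨ T , seed (2 ℕ.* i) ⟩) (𝔹.xor-same t) ⟩
      ⟨ T , seed (2 ℕ.* i) ⟩                      ≡⟨ seed-even i T ⟩
      ⟨ T , l₀ ⟩                                  ∎
      where
      open ≡-Reasoning
      t : Bool
      t = ⟨ T , constant true ⟩

    seed-odd : ∀ i T → ⟨ T , seed (suc (2 ℕ.* i)) ⟩ ≡ ⟨ T , l₁ ⟩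
    seed-odd i T = trans (step (2 ℕ.* i) T)
      (trans (cong (⟨ T , constant true ⟩ xor_) (seed-even i T)) (sym (⟨⟩-l₁ T)))

    even-coset : ∀ i → coset (seed (2 ℕ.* i)) ≡ H₀
    even-coset i = sym (coset-cong {l₀} {seed (2 ℕ.* i)} (λ T _ → seed-even i T))

    odd-coset : ∀ i → coset (seed (suc (2 ℕ.* i))) ≡ H₁
    odd-coset i = sym (coset-cong {l₁} {seed (suc (2 ℕ.* i))} (λ T _ → seed-odd i T))

    seed-cases : ∀ i → (∀ T → ⟨ T , seed i ⟩ ≡ ⟨ T , l₀ ⟩) ⊎ (∀ T → ⟨ T , seed i ⟩ ≡ ⟨ T , l₁ ⟩)
    seed-cases zero    = inj₁ (λ _ → refl)
    seed-cases (suc i) with seed-cases i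
    ... | inj₁ h = inj₂ λ T → trans (step i T) (trans (cong (⟨ T , constant true ⟩ xor_) (h T)) (sym (⟨⟩-l₁ T)))
    ... | inj₂ h = inj₁ λ T → let t = ⟨ T , constant true ⟩ in
      trans (step i T) (trans (cong (t xor_) (trans (h T) (⟨⟩-l₁ T)))
        (trans (sym (𝔹.xor-assoc t t _)) (cong (_xor ⟨ T , l₀ ⟩) (𝔹.xor-same t))))

    ProcessSupp⇒ : ∀ f → ProcessSupp π f → Coset l₀ f ⊎ Coset l₁ f
    ProcessSupp⇒ f (i , _ , 0<πf) with seed-cases i
    ... | inj₁ h = inj₁ λ T T-bal → trans (Supp⇒Coset i f 0<πf T T-bal) (h T)
    ... | inj₂ h = inj₂ λ T T-bal → trans (Supp⇒Coset i f 0<πf T T-bal) (h T)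

    N≤2*N : ∀ N → N ≤ 2 ℕ.* N
    N≤2*N N = ℕₚ.m≤m+n N (N ℕ.+ 0)

    ⇒ProcessSupp : ∀ f → Coset l₀ f ⊎ Coset l₁ f → ProcessSupp π f
    ⇒ProcessSupp f (inj₁ f∈) = recurrent⇒ProcessSupp l₀
      (λ N → 2 ℕ.* suc N , ℕₚ.≤-trans (ℕₚ.n≤1+n N) (N≤2*N (suc N)) , s≤s z≤n , even-coset (suc N)) f f∈
    ⇒ProcessSupp f (inj₂ f∈) = recurrent⇒ProcessSupp l₁
      (λ N → suc (2 ℕ.* N) , ℕₚ.m≤n⇒m≤1+n (N≤2*N N) , s≤s z≤n , odd-coset N) f f∈

    disjoint : ∀ f → Coset l₀ f → ¬ Coset l₁ f
    disjoint f f∈₀ f∈₁ = absurd (trans (sym (f∈₀ T₁ T₁-balanced)) (trans (f∈₁ T₁ T₁-balanced)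
      (trans (⟨⟩-l₁ T₁) (cong (_xor ⟨ T₁ , l₀ ⟩) T₁-separates))))
      where
      absurd : ∀ {b} → ¬ b ≡ not b
      absurd {false} ()
      absurd {true}  ()

    enumerates : S Enumerates ProcessSupp π
    enumerates =
      Uniqueₚ.++⁺ (BoolFunSetoid n) (coset-unique l₀) (coset-unique l₁)
        (λ {f} (f∈₀ , f∈₁) → disjoint f (∈-coset⁻ {l₀} f∈₀) (∈-coset⁻ {l₁} f∈₁)) ,
      λ f → mk⇔
        (λ f∈ → ⇒ProcessSupp f ([ inj₁ ∘ ∈-coset⁻ {l₀} , inj₂ ∘ ∈-coset⁻ {l₁} ]′ (∈ₚ.∈-++⁻ (BoolFunSetoid n) H₀ f∈)))
        (λ f∈ → [ ∈ₚ.∈-++⁺ˡ (BoolFunSetoid n) ∘ ∈-coset⁺ {l₀}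
                , ∈ₚ.∈-++⁺ʳ (BoolFunSetoid n) H₀ ∘ ∈-coset⁺ {l₁} ]′ (ProcessSupp⇒ f f∈))

    double-length : ∀ s → 2 ℕ.* length (coset s) ≡ length S
    double-length s = begin
      length (coset s) ℕ.+ (length (coset s) ℕ.+ 0)   ≡⟨ cong (length (coset s) ℕ.+_) (ℕₚ.+-identityʳ _) ⟩
      length (coset s) ℕ.+ length (coset s)           ≡⟨ cong₂ ℕ._+_ (length-coset s l₀) (length-coset s l₁) ⟩
      length H₀ ℕ.+ length H₁                         ≡⟨ sym (Listₚ.length-++ H₀) ⟩
      length S                                        ∎
      where
      open ≡-Reasoning

    half₀ : H₀ HalfOf S
    half₀ = coset-unique l₀ , ∈ₚ.∈-++⁺ˡ (BoolFunSetoid n) , double-length l₀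

    half₁ : H₁ HalfOf S
    half₁ = coset-unique l₁ , ∈ₚ.∈-++⁺ʳ (BoolFunSetoid n) H₀ , double-length l₁

    limits : AlternatingLimits π (uniform H₀) (uniform H₁)
    limits = even , odd , distinct
      where
      even : (λ i → π (2 ℕ.* i)) ⟶ uniform H₀
      even f ε 0<ε = let N , near = convergence f ε 0<ε in
        N , λ i N≤i → subst (λ S → ∣ π (2 ℕ.* i) f - uniform S f ∣ <ℚ ε) (even-coset i)
                        (near (2 ℕ.* i) (ℕₚ.≤-trans N≤i (N≤2*N i)))
      odd : (λ i → π (suc (2 ℕ.* i))) ⟶ uniform H₁
      odd f ε 0<ε = let N , near = convergence f ε 0<ε in
        N , λ i N≤i → subst (λ S → ∣ π (suc (2 ℕ.* i)) f - uniform S f ∣ <ℚ ε) (odd-coset i)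
                        (near (suc (2 ℕ.* i)) (ℕₚ.m≤n⇒m≤1+n (ℕₚ.≤-trans N≤i (N≤2*N i))))
      distinct : ¬ (uniform H₀ ≗ uniform H₁)
      distinct eq = ℚₚ.<-irrefl
        (sym (trans (eq l₀) (uniform-∉ (λ l₀∈ → disjoint l₀ (λ _ _ → refl) (∈-coset⁻ {l₁} l₀∈)))))
        (uniform-∈ (∈-coset⁺ {l₀} {l₀} (λ _ _ → refl)))

-- Linear functions

zeros ones : ∀ n → Vec Bool n
zeros n = replicate n false
ones  n = replicate n true

zipWith-xor-zeros : ∀ {n} (v : Vec Bool n) → zipWith _xor_ (zeros n) v ≡ v
zipWith-xor-zeros []      = refl
zipWith-xor-zeros (b ∷ v) = cong (b ∷_) (zipWith-xor-zeros v)

parity-∧-zeros : ∀ {n} (cs : Vec Bool n) → parity (zipWith _∧_ cs (zeros n)) ≡ false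
parity-∧-zeros []       = refl
parity-∧-zeros (c ∷ cs) = cong₂ _xor_ (𝔹.∧-zeroʳ c) (parity-∧-zeros cs)

parity-∧-ones : ∀ {n} (cs : Vec Bool n) → parity (zipWith _∧_ cs (ones n)) ≡ parity cs
parity-∧-ones []       = refl
parity-∧-ones (c ∷ cs) = cong₂ _xor_ (𝔹.∧-identityʳ c) (parity-∧-ones cs)

-- The functional f(u) + f(v) + f(u + v) + f(0).
defect : ∀ {n} → Vec Bool n → Vec Bool n → BoolFun n
defect {n} u v = δ u ⊕ δ v ⊕ δ (zipWith _xor_ u v) ⊕ δ (zeros n)

⟨defect,⟩ : ∀ {n} u v (f : BoolFun n) →
            ⟨ defect u v , f ⟩ ≡ ((f u xor f v) xor f (zipWith _xor_ u v)) xor f (zeros n)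
⟨defect,⟩ {n} u v f =
  trans (⟨⟩-⊕ˡ (δ u ⊕ δ v ⊕ δ (zipWith _xor_ u v)) (δ (zeros n)) f) (cong₂ _xor_
    (trans (⟨⟩-⊕ˡ (δ u ⊕ δ v) (δ (zipWith _xor_ u v)) f) (cong₂ _xor_
      (trans (⟨⟩-⊕ˡ (δ u) (δ v) f) (cong₂ _xor_ (⟨δ,⟩ u f) (⟨δ,⟩ v f)))
      (⟨δ,⟩ (zipWith _xor_ u v) f)))
    (⟨δ,⟩ (zeros n) f))

-- The conditions f(u + v) = f(u) + f(v) + f(0).
Affine : ∀ {n} → BoolFun n → Set
Affine f = ∀ u v → ⟨ defect u v , f ⟩ ≡ false

constant-affine : ∀ {n} b → Affine {n} (constant b)
constant-affine b u v = trans (⟨defect,⟩ u v (constant b))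
  (trans (cong (λ z → (z xor b) xor b) (𝔹.xor-same b)) (𝔹.xor-same b))

projection-affine : ∀ {n} (j : Fin n) → Affine (projection j)
projection-affine {n} j u v = trans (⟨defect,⟩ u v (projection j)) (begin
  ((lookup u j xor lookup v j) xor lookup (zipWith _xor_ u v) j) xor lookup (zeros n) j
    ≡⟨ cong₂ (λ x y → ((lookup u j xor lookup v j) xor x) xor y)
         (Vecₚ.lookup-zipWith _xor_ j u v) (Vecₚ.lookup-replicate j false) ⟩
  ((lookup u j xor lookup v j) xor (lookup u j xor lookup v j)) xor false
    ≡⟨ cong (_xor false) (𝔹.xor-same (lookup u j xor lookup v j)) ⟩
  false ∎)
  where
  open ≡-Reasoning

-- Induction on n: the coefficient of x₁ is f(1,0,…,0) + f(0,…,0), and the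
-- restriction to x₁ = 0 supplies the others.
Affine⇒Linear : ∀ {n} (f : BoolFun n) → Affine f → Linear f
Affine⇒Linear {zero}  f aff = f [] , [] , λ where [] → sym (𝔹.xor-identityʳ (f []))
Affine⇒Linear {suc n} f aff =
  let c₀ , cs , rest≗ = Affine⇒Linear (f ∘ (false ∷_)) λ u v →
        trans (⟨defect,⟩ u v (f ∘ (false ∷_)))
          (trans (sym (⟨defect,⟩ (false ∷ u) (false ∷ v) f)) (aff (false ∷ u) (false ∷ v)))
      c₁ = f (true ∷ zeros n) xor f (false ∷ zeros n)
  in c₀ , c₁ ∷ cs , λ where
    (false ∷ v) → trans (rest≗ v) (cong (λ z → c₀ xor (z xor parity (zipWith _∧_ cs v))) (sym (𝔹.∧-zeroʳ c₁)))
    (true  ∷ v) → begin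
      f (true ∷ v)
        ≡⟨ sym (solve 4 (λ a b c d → a :+ (b :+ d) :+ (((a :+ b) :+ c) :+ d) := c) refl
             (f (true ∷ zeros n)) (f (false ∷ v)) (f (true ∷ v)) (f (false ∷ zeros n))) ⟩
      (f (true ∷ zeros n) xor (f (false ∷ v) xor f (false ∷ zeros n)))
        xor (((f (true ∷ zeros n) xor f (false ∷ v)) xor f (true ∷ v)) xor f (false ∷ zeros n))
        ≡⟨ cong (λ z → (f (true ∷ zeros n) xor (f (false ∷ v) xor f (false ∷ zeros n))) xor z) (sum≡false v) ⟩
      (f (true ∷ zeros n) xor (f (false ∷ v) xor f (false ∷ zeros n))) xor false
        ≡⟨ cong (λ z → (f (true ∷ zeros n) xor (z xor f (false ∷ zeros n))) xor false) (rest≗ v) ⟩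
      (f (true ∷ zeros n) xor ((c₀ xor parity (zipWith _∧_ cs v)) xor f (false ∷ zeros n))) xor false
        ≡⟨ solve 4 (λ a c p d → a :+ ((c :+ p) :+ d) :+ con false := c :+ ((a :+ d) :+ p)) refl
             (f (true ∷ zeros n)) c₀ (parity (zipWith _∧_ cs v)) (f (false ∷ zeros n)) ⟩
      c₀ xor (c₁ xor parity (zipWith _∧_ cs v))
        ≡⟨ cong (λ z → c₀ xor (z xor parity (zipWith _∧_ cs v))) (sym (𝔹.∧-identityʳ c₁)) ⟩
      c₀ xor ((c₁ ∧ true) xor parity (zipWith _∧_ cs v)) ∎
  where
  open ≡-Reasoning
  open xor-∧-Solver
  sum≡false : ∀ v → ((f (true ∷ zeros n) xor f (false ∷ v)) xor f (true ∷ v)) xor f (false ∷ zeros n) ≡ false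
  sum≡false v = trans
    (cong (λ z → ((f (true ∷ zeros n) xor f (false ∷ v)) xor f (true ∷ z)) xor f (false ∷ zeros n))
      (sym (zipWith-xor-zeros v)))
    (trans (sym (⟨defect,⟩ (true ∷ zeros n) (false ∷ v) f)) (aff (true ∷ zeros n) (false ∷ v)))

-- A functional with the same value σ on all projections.
⟨⟩-linear : ∀ {n} (T : BoolFun n) σ → (∀ j → ⟨ T , projection j ⟩ ≡ σ) → ∀ c₀ cs →
            ⟨ T , linear c₀ cs ⟩ ≡ ⟨ T , constant c₀ ⟩ xor (parity cs ∧ σ)
⟨⟩-linear {n} T σ T-proj c₀ cs = trans (⟨⟩-⊕ʳ T (constant c₀) (λ v → parity (zipWith _∧_ cs v)))
  (cong (⟨ T , constant c₀ ⟩ xor_) (trans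
    (⟨⟩-cong {S = T} (λ _ → refl) (λ v → cong (parity ∘ zipWith _∧_ cs) (sym (Vecₚ.tabulate∘lookup v))))
    (combination projection T-proj cs)))
  where
  combination : ∀ {m} (p : Fin m → BoolFun n) → (∀ j → ⟨ T , p j ⟩ ≡ σ) → ∀ cs →
                ⟨ T , (λ v → parity (zipWith _∧_ cs (Vec.tabulate (λ j → p j v)))) ⟩ ≡ parity cs ∧ σ
  combination p T-p []       = ⟨⟩-zeroʳ T
  combination p T-p (c ∷ cs) = begin
    ⟨ T , (λ v → c ∧ p zero v) ⊕ rest ⟩              ≡⟨ ⟨⟩-⊕ʳ T (λ v → c ∧ p zero v) rest ⟩
    ⟨ T , (λ v → c ∧ p zero v) ⟩ xor ⟨ T , rest ⟩    ≡⟨ cong₂ _xor_ (scale c) (combination (p ∘ suc) (T-p ∘ suc) cs) ⟩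
    (c ∧ σ) xor (parity cs ∧ σ)                      ≡⟨ sym (𝔹.∧-distribʳ-xor σ c (parity cs)) ⟩
    (c xor parity cs) ∧ σ                            ∎
    where
    open ≡-Reasoning
    rest : BoolFun n
    rest v = parity (zipWith _∧_ cs (Vec.tabulate (λ j → p (suc j) v)))
    scale : ∀ c → ⟨ T , (λ v → c ∧ p zero v) ⟩ ≡ c ∧ σ
    scale false = ⟨⟩-zeroʳ T
    scale true  = T-p zero

-- The initial functions

-- No negations are present; z and o tell whether the constants 0 and 1 are.
choice : Bool → Bool → InitialChoice
choice z o = record { withNegations = false ; withZero = z ; withOne = o }

projection-injective : ∀ {n} {i j : Fin n} → projection i ≗ projection j → i ≡ j
projection-injective {n} {i} {j} eq with i Fin.≟ j
... | yes i≡j = i≡j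
... | no  i≢j = case trans (sym (Vecₚ.lookup∘updateAt i (zeros n)))
    (trans (eq (Vec.updateAt (zeros n) i (λ _ → true)))
      (trans (Vecₚ.lookup∘updateAt′ j i (i≢j ∘ sym) (zeros n)) (Vecₚ.lookup-replicate j false))) of λ ()

projection≇constant : ∀ {n} (j : Fin n) b → ¬ (projection j ≗ constant b)
projection≇constant {n} j b eq = 𝔹.not-¬ {b} refl
  (sym (trans (sym (Vecₚ.lookup-replicate j (not b))) (eq (replicate n (not b)))))

module _ {n : ℕ} where

  All-initial : ∀ {p} {P : BoolFun n → Set p} z o → (∀ j → P (projection j)) →
                (z ≡ true → P (constant false)) → (o ≡ true → P (constant true)) →
                All P (initialSet n (choice z o))
  All-initial z o at-proj at-zero at-one =
    Allₚ.++⁺ (Allₚ.map⁺ (Allₚ.tabulate⁺ at-proj)) (Allₚ.++⁺ (zero-part z at-zero) (one-part o at-one))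
    where
    zero-part : ∀ z → (z ≡ true → _) → All _ (if z then [ constant false ] else [])
    zero-part true  P0 = P0 refl ∷ []
    zero-part false _  = []
    one-part : ∀ o → (o ≡ true → _) → All _ (if o then [ constant true ] else [])
    one-part true  P1 = P1 refl ∷ []
    one-part false _  = []

  ∉-initial : ∀ {f : BoolFun n} z o → (∀ j → ¬ (f ≗ projection j)) →
              (z ≡ true → ¬ (f ≗ constant false)) → (o ≡ true → ¬ (f ≗ constant true)) →
              ¬ f ∈ initialSet n (choice z o)
  ∉-initial z o at-proj at-zero at-one = Allₚ.All¬⇒¬Any (All-initial z o at-proj at-zero at-one)

  projection∈initial : ∀ z o (j : Fin n) → projection j ∈ initialSet n (choice z o)
  projection∈initial z o j = ∈ₚ.∈-++⁺ˡ (BoolFunSetoid n)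
    (Anyₚ.map⁺ (Anyₚ.tabulate⁺ j (λ _ → refl)))

  zero∈initial : ∀ o → constant false ∈ initialSet n (choice true o)
  zero∈initial o = ∈ₚ.∈-++⁺ʳ (BoolFunSetoid n) (map projection (allFin n)) (here (λ _ → refl))

  one∈initial : ∀ z → constant true ∈ initialSet n (choice z true)
  one∈initial z = ∈ₚ.∈-++⁺ʳ (BoolFunSetoid n) (map projection (allFin n))
    (∈ₚ.∈-++⁺ʳ (BoolFunSetoid n) (if z then [ constant false ] else []) (here (λ _ → refl)))

  zero∉initial : ∀ z o → z ≡ false → ¬ constant false ∈ initialSet n (choice z o)
  zero∉initial z o refl = ∉-initial false o
    (λ j eq → projection≇constant j false (λ v → sym (eq v)))
    (λ ()) (λ _ eq → case eq (zeros n) of λ ())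

  one∉initial : ∀ z o → o ≡ false → ¬ constant true ∈ initialSet n (choice z o)
  one∉initial z o refl = ∉-initial z false
    (λ j eq → projection≇constant j true (λ v → sym (eq v)))
    (λ _ eq → case eq (zeros n) of λ ()) (λ ())

  initialSet-unique : ∀ z o → Unique (initialSet n (choice z o))
  initialSet-unique z o = Uniqueₚ.++⁺ (BoolFunSetoid n)
    (Uniqueₚ.map⁺ (setoid (Fin n)) (BoolFunSetoid n) projection-injective (Uniqueₚ.tabulate⁺ (setoid (Fin n)) id))
    (constants-unique z o)
    (λ {f} (f∈ , f∈′) → let j , _ , f≗ = ∈ₚ.∈-map⁻ (setoid (Fin n)) (BoolFunSetoid n) f∈ in
       not-constant z o f j f≗ f∈′)
    where
    constants : Bool → Bool → List (BoolFun n)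
    constants z o = (if z then [ constant false ] else []) ++ (if o then [ constant true ] else [])
    constants-unique : ∀ z o → Unique (constants z o)
    constants-unique false false = []
    constants-unique false true  = [] ∷ []
    constants-unique true  false = [] ∷ []
    constants-unique true  true  = ((λ eq → case eq (zeros n) of λ ()) ∷ []) ∷ [] ∷ []
    not-constant : ∀ z o f j → f ≗ projection j → ¬ f ∈ constants z o
    not-constant z o f j f≗ f∈ with ∈ₚ.∈-++⁻ (BoolFunSetoid n) (if z then [ constant false ] else []) f∈
    not-constant true o f j f≗ f∈ | inj₁ (here eq) = projection≇constant j false (λ v → trans (sym (f≗ v)) (eq v))
    not-constant z true f j f≗ f∈ | inj₂ (here eq) = projection≇constant j true (λ v → trans (sym (f≗ v)) (eq v))

-- Growth from projections and constants

-- The initial functions other than the first projection are abstracted to a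
-- list L, which keeps the types of the lemmas small.
module ProjectionProcess (m k : ℕ) (1<k : 1 < k) (c z o : Bool) (L : List (BoolFun (suc m)))
  (L-initial : initialSet (suc m) (choice z o) ≡ projection zero ∷ L) where

  n : ℕ
  n = suc m

  open Limits k 1<k c (projection zero) L (subst Unique L-initial (initialSet-unique z o))

  μ : Distribution n
  μ = uniform (projection zero ∷ L)

  ∈-L : ∀ {f : BoolFun n} → f ∈ initialSet n (choice z o) → f ∈ projection zero ∷ L
  ∈-L {f} = subst (f ∈_) L-initial

  ∉-L : ∀ {f : BoolFun n} → ¬ f ∈ initialSet n (choice z o) → ¬ f ∈ projection zero ∷ L
  ∉-L {f} = subst (λ S → ¬ f ∈ S) L-initial

  balanced : ∀ T → (∀ j → ⟨ T , projection j ⟩ ≡ ⟨ T , projection zero ⟩) →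
             (z ≡ true → ⟨ T , constant false ⟩ ≡ ⟨ T , projection zero ⟩) →
             (o ≡ true → ⟨ T , constant true ⟩ ≡ ⟨ T , projection zero ⟩) → Balanced T
  balanced T at-proj at-zero at-one = All.tail (subst (All _) L-initial (All-initial z o at-proj at-zero at-one))

  balanced-projection : ∀ T → Balanced T → ∀ j → ⟨ T , projection j ⟩ ≡ ⟨ T , projection zero ⟩
  balanced-projection T T-bal j = ∈-initial⇒ T T-bal (∈-L (projection∈initial z o j))

  balanced-zero : ∀ T → Balanced T → z ≡ true → ⟨ T , projection zero ⟩ ≡ false
  balanced-zero T T-bal refl = trans (sym (∈-initial⇒ T T-bal (∈-L (zero∈initial o)))) (⟨⟩-zeroʳ T)

  balanced-one : ∀ T → Balanced T → o ≡ true → ⟨ T , constant true ⟩ ≡ ⟨ T , projection zero ⟩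
  balanced-one T T-bal refl = ∈-initial⇒ T T-bal (∈-L (one∈initial z))

  Supp-zero⁺ : z ≡ true → Supp μ (constant false)
  Supp-zero⁺ refl = uniform-∈ (∈-L (zero∈initial o))

  Supp-one⁺ : o ≡ true → Supp μ (constant true)
  Supp-one⁺ refl = uniform-∈ (∈-L (one∈initial z))

  Supp-zero⁻ : Supp μ (constant false) → z ≡ true
  Supp-zero⁻ supp = decidable-stable (z 𝔹.≟ true) λ z≢ →
    ℚₚ.<-irrefl (sym (uniform-∉ (∉-L (zero∉initial z o (𝔹.¬-not z≢))))) supp

  Supp-one⁻ : Supp μ (constant true) → o ≡ true
  Supp-one⁻ supp = decidable-stable (o 𝔹.≟ true) λ o≢ →
    ℚₚ.<-irrefl (sym (uniform-∉ (∉-L (one∉initial z o (𝔹.¬-not o≢))))) supp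

  Exceptional : Set
  Exceptional = ¬ (Supp μ (constant false) × Supp μ (constant true)) × k % 2 ≡ 1 × c ≡ true

  -- If 1 is not initial, evaluation at 0…0 is zero on the initial functions; if 0
  -- is not initial, evaluation at 1…1 is one on them. Both are one at the
  -- constant 1.
  separating : ¬ (z ≡ true × o ≡ true) → ∃ λ T → Balanced T × ⟨ T , constant true ⟩ ≡ true
  separating ¬both = by-cases (z 𝔹.≟ true) (o 𝔹.≟ true)
    where
    by-cases : Dec (z ≡ true) → Dec (o ≡ true) → ∃ λ T → Balanced T × ⟨ T , constant true ⟩ ≡ true
    by-cases (yes z≡) (yes o≡) = ⊥-elim (¬both (z≡ , o≡))
    by-cases _        (no  o≢) = δ (zeros n) , balanced (δ (zeros n))
      (λ j → trans (⟨δ,⟩ (zeros n) (projection j))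
        (trans (Vecₚ.lookup-replicate j false) (sym (⟨δ,⟩ (zeros n) (projection zero)))))
      (λ _ → trans (⟨δ,⟩ (zeros n) (constant false)) (sym (⟨δ,⟩ (zeros n) (projection zero))))
      (λ o≡ → ⊥-elim (o≢ o≡)) , ⟨δ,⟩ (zeros n) (constant true)
    by-cases (no  z≢) (yes _)  = δ (ones n) , balanced (δ (ones n))
      (λ j → trans (⟨δ,⟩ (ones n) (projection j))
        (trans (Vecₚ.lookup-replicate j true) (sym (⟨δ,⟩ (ones n) (projection zero)))))
      (λ z≡ → ⊥-elim (z≢ z≡))
      (λ _ → trans (⟨δ,⟩ (ones n) (constant true)) (sym (⟨δ,⟩ (ones n) (projection zero)))) ,
      ⟨δ,⟩ (ones n) (constant true)

  seed-suc-odd : k % 2 ≡ 1 → ∀ i T → ⟨ T , seed (suc i) ⟩ ≡ ⟨ T , constant c ⟩ xor ⟨ T , seed i ⟩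
  seed-suc-odd odd i T = trans (⟨⟩-seed-suc i T) (cong (⟨ T , constant c ⟩ xor_) (parity-replicate-odd k ⟨ T , seed i ⟩ odd))

  seed-suc-even : k % 2 ≡ 0 → ∀ i T → ⟨ T , seed (suc i) ⟩ ≡ ⟨ T , constant c ⟩
  seed-suc-even even i T = trans (⟨⟩-seed-suc i T)
    (trans (cong (⟨ T , constant c ⟩ xor_) (parity-replicate-even k ⟨ T , seed i ⟩ even)) (𝔹.xor-identityʳ ⟨ T , constant c ⟩))

  -- Functions paired like b + x₁ lie in the coset of x₁ + b.
  constant-coset : ∀ b f → (∀ T → Balanced T → ⟨ T , f ⟩ ≡ ⟨ T , constant b ⟩ xor ⟨ T , projection zero ⟩) →
                   Coset (projection zero) f ⊎ Coset l₁ f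
  constant-coset false f h = inj₁ λ T T-bal → trans (h T T-bal) (cong (_xor ⟨ T , projection zero ⟩) (⟨⟩-zeroʳ T))
  constant-coset true  f h = inj₂ λ T T-bal → trans (h T T-bal) (sym (⟨⟩-⊕ʳ T (constant true) (projection zero)))

  odd-linear-in-coset : ∀ f c₀ cs → parity cs ≡ true → f ≗ linear c₀ cs →
                        Coset (projection zero) f ⊎ Coset l₁ f
  odd-linear-in-coset f c₀ cs odd f≗ = constant-coset c₀ f λ T T-bal →
    trans (⟨⟩-cong {S = T} (λ _ → refl) f≗)
      (trans (⟨⟩-linear T ⟨ T , projection zero ⟩ (balanced-projection T T-bal) c₀ cs)
        (cong (λ p → ⟨ T , constant c₀ ⟩ xor (p ∧ ⟨ T , projection zero ⟩)) odd))

  -- For even parity f is paired like its constant term. If 0 is initial, a balanced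
  -- T vanishes on x₁; if 1 is initial, it takes the same value on x₁ and on 1.
  linear-in-coset : z ≡ true ⊎ o ≡ true → ∀ f → Linear f → Coset (projection zero) f ⊎ Coset l₁ f
  linear-in-coset present f (c₀ , cs , f≗) = by-cases (parity cs) refl present
    where
    ⟨⟩-f : ∀ T → Balanced T → ⟨ T , f ⟩ ≡ ⟨ T , constant c₀ ⟩ xor (parity cs ∧ ⟨ T , projection zero ⟩)
    ⟨⟩-f T T-bal = trans (⟨⟩-cong {S = T} (λ _ → refl) f≗)
      (⟨⟩-linear T ⟨ T , projection zero ⟩ (balanced-projection T T-bal) c₀ cs)
    shift : ∀ T c₀ → ⟨ T , constant c₀ ⟩ xor false ≡ ⟨ T , constant (not c₀) ⟩ xor ⟨ T , constant true ⟩
    shift T false = trans (cong (_xor false) (⟨⟩-zeroʳ T)) (sym (𝔹.xor-same ⟨ T , constant true ⟩))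
    shift T true  = trans (𝔹.xor-identityʳ _) (sym (cong (_xor ⟨ T , constant true ⟩) (⟨⟩-zeroʳ T)))
    by-cases : ∀ p → parity cs ≡ p → z ≡ true ⊎ o ≡ true → Coset (projection zero) f ⊎ Coset l₁ f
    by-cases true  eq _         = odd-linear-in-coset f c₀ cs eq f≗
    by-cases false eq (inj₁ z≡) = constant-coset c₀ f λ T T-bal →
      trans (⟨⟩-f T T-bal) (cong (⟨ T , constant c₀ ⟩ xor_)
        (trans (cong (_∧ ⟨ T , projection zero ⟩) eq) (sym (balanced-zero T T-bal z≡))))
    by-cases false eq (inj₂ o≡) = constant-coset (not c₀) f λ T T-bal →
      trans (⟨⟩-f T T-bal)
        (trans (cong (λ p → ⟨ T , constant c₀ ⟩ xor (p ∧ ⟨ T , projection zero ⟩)) eq)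
          (trans (shift T c₀) (cong (⟨ T , constant (not c₀) ⟩ xor_) (balanced-one T T-bal o≡))))

  -- The defect functionals vanish on all initial functions, hence are balanced,
  -- and they vanish on the constant 1.
  coset-linear : ∀ f → Coset (projection zero) f ⊎ Coset l₁ f → Linear f
  coset-linear f f∈ = Affine⇒Linear f λ u v →
    [ (λ h → trans (h (defect u v) (defect-balanced u v)) (projection-affine zero u v))
    , (λ h → trans (h (defect u v) (defect-balanced u v))
        (trans (⟨⟩-⊕ʳ (defect u v) (constant true) (projection zero))
          (cong₂ _xor_ (constant-affine true u v) (projection-affine {n} zero u v)))) ]′ f∈
    where
    defect-balanced : ∀ u v → Balanced (defect u v)
    defect-balanced u v = balanced (defect u v)
      (λ j → trans (projection-affine j u v) (sym (projection-affine {n} zero u v)))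
      (λ _ → trans (constant-affine false u v) (sym (projection-affine {n} zero u v)))
      (λ _ → trans (constant-affine true u v) (sym (projection-affine {n} zero u v)))

  -- f(0…0) + f(1…1) is one on all projections and zero on the constant 1.
  coset-odd : z ≡ false → o ≡ false → ∀ f → Coset (projection zero) f ⊎ Coset l₁ f →
              ∀ c₀ cs → f ≗ linear c₀ cs → parity cs ≡ true
  coset-odd z≡ o≡ f f∈ c₀ cs f≗ = begin
    parity cs
      ≡⟨ sym (trans (cong (_xor c₀) (𝔹.xor-comm c₀ (parity cs))) (xor-cancelʳ (parity cs) c₀)) ⟩
    (c₀ xor parity cs) xor c₀
      ≡⟨ cong₂ _xor_ (cong (c₀ xor_) (sym (parity-∧-ones cs)))
                     (trans (sym (𝔹.xor-identityʳ c₀)) (cong (c₀ xor_) (sym (parity-∧-zeros cs)))) ⟩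
    linear c₀ cs (ones n) xor linear c₀ cs (zeros n)
      ≡⟨ cong₂ _xor_ (sym (f≗ (ones n))) (sym (f≗ (zeros n))) ⟩
    f (ones n) xor f (zeros n)
      ≡⟨ sym (⟨T,⟩ f) ⟩
    ⟨ T , f ⟩
      ≡⟨ [ (λ h → trans (h T T-bal) (T-proj zero))
         , (λ h → trans (h T T-bal) (trans (⟨⟩-⊕ʳ T (constant true) (projection zero))
             (cong₂ _xor_ (⟨T,⟩ (constant true)) (T-proj zero)))) ]′ f∈ ⟩
    true ∎
    where
    open ≡-Reasoning
    T : BoolFun n
    T = δ (ones n) ⊕ δ (zeros n)
    ⟨T,⟩ : ∀ g → ⟨ T , g ⟩ ≡ g (ones n) xor g (zeros n)
    ⟨T,⟩ g = trans (⟨⟩-⊕ˡ (δ (ones n)) (δ (zeros n)) g) (cong₂ _xor_ (⟨δ,⟩ (ones n) g) (⟨δ,⟩ (zeros n) g))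
    T-proj : ∀ j → ⟨ T , projection j ⟩ ≡ true
    T-proj j = trans (⟨T,⟩ (projection j)) (cong₂ _xor_ (Vecₚ.lookup-replicate j true) (Vecₚ.lookup-replicate j false))
    T-bal : Balanced T
    T-bal = balanced T (λ j → trans (T-proj j) (sym (T-proj zero)))
      (λ z≡true → case trans (sym z≡) z≡true of λ ()) (λ o≡true → case trans (sym o≡) o≡true of λ ())

  -- The case of odd k and c = 1 with a constant missing.
  module OddComplemented (odd : k % 2 ≡ 1) (c≡true : c ≡ true) (¬both : ¬ (z ≡ true × o ≡ true)) where

    separator : ∃ λ T → Balanced T × ⟨ T , constant true ⟩ ≡ true
    separator = separating ¬both

    step : ∀ i T → ⟨ T , seed (suc i) ⟩ ≡ ⟨ T , constant true ⟩ xor ⟨ T , seed i ⟩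
    step i T = trans (seed-suc-odd odd i T) (cong (λ b → ⟨ T , constant b ⟩ xor ⟨ T , seed i ⟩) c≡true)

    open Alternating step (proj₁ separator) (proj₁ (proj₂ separator)) (proj₂ (proj₂ separator))

    alternation : ∃[ S ] ∃[ H₀ ] ∃[ H₁ ]
      S Enumerates ProcessSupp π × H₀ HalfOf S × H₁ HalfOf S ×
      AlternatingLimits π (uniform H₀) (uniform H₁)
    alternation = S , H₀ , H₁ , enumerates , half₀ , half₁ , limits

    support-without-constants : z ≡ false → o ≡ false → ∀ f →
      ProcessSupp π f ⇔ (∃[ c₀ ] ∃[ cs ] parity cs ≡ true × f ≗ linear c₀ cs)
    support-without-constants z≡ o≡ f = mk⇔ to
      (λ (c₀ , cs , cs-odd , f≗) → ⇒ProcessSupp f (odd-linear-in-coset f c₀ cs cs-odd f≗))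
      where
      to : ProcessSupp π f → ∃[ c₀ ] ∃[ cs ] parity cs ≡ true × f ≗ linear c₀ cs
      to f∈ = case coset-linear f (ProcessSupp⇒ f f∈) of λ where
        (c₀ , cs , f≗) → c₀ , cs , coset-odd z≡ o≡ f (ProcessSupp⇒ f f∈) c₀ cs f≗ , f≗

    support-with-constant : z ≡ true ⊎ o ≡ true → ∀ f → ProcessSupp π f ⇔ Linear f
    support-with-constant present f = mk⇔
      (λ f∈ → coset-linear f (ProcessSupp⇒ f f∈))
      (λ f-linear → ⇒ProcessSupp f (linear-in-coset present f f-linear))

  exceptional : Exceptional →
    (∃[ S ] ∃[ H₀ ] ∃[ H₁ ]
      S Enumerates ProcessSupp π × H₀ HalfOf S × H₁ HalfOf S ×
      AlternatingLimits π (uniform H₀) (uniform H₁))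
    × (¬ Supp μ (constant false) → ¬ Supp μ (constant true) →
        ∀ f → ProcessSupp π f ⇔ (∃[ c₀ ] ∃[ cs ] parity cs ≡ true × f ≗ linear c₀ cs))
    × (Supp μ (constant false) ⊎ Supp μ (constant true) →
        ∀ f → ProcessSupp π f ⇔ Linear f)
  exceptional (¬both , odd , c≡true) =
    alternation ,
    (λ no-zero no-one → support-without-constants
      (𝔹.¬-not (λ z≡ → no-zero (Supp-zero⁺ z≡))) (𝔹.¬-not (λ o≡ → no-one (Supp-one⁺ o≡)))) ,
    (λ present → support-with-constant (Sum.map Supp-zero⁻ Supp-one⁻ present))
    where
    open OddComplemented odd c≡true (λ (z≡ , o≡) → ¬both (Supp-zero⁺ z≡ , Supp-one⁺ o≡))

  unexceptional : ¬ Exceptional → ∃[ S ] S Enumerates ProcessSupp π × (π ⟶ uniform S)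
  unexceptional ¬exc = stationary (step (k % 2) refl (m%n<n k 2) c refl)
    where
    step : ∀ r → k % 2 ≡ r → r < 2 → ∀ b → c ≡ b →
           ∀ i T → Balanced T → ⟨ T , seed (suc (suc i)) ⟩ ≡ ⟨ T , seed (suc i) ⟩
    step 0 even _ _ _ i T _ = trans (seed-suc-even even (suc i) T) (sym (seed-suc-even even i T))
    step 1 odd  _ false refl i T _ = trans (seed-suc-odd odd (suc i) T) (cong (_xor ⟨ T , seed (suc i) ⟩) (⟨⟩-zeroʳ T))
    step 1 odd  _ true  refl i T T-bal = trans (seed-suc-odd odd (suc i) T)
      (cong (_xor ⟨ T , seed (suc i) ⟩) (trans (balanced-one T T-bal (proj₂ both)) (balanced-zero T T-bal (proj₁ both))))
      where
      both : z ≡ true × o ≡ true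
      both = decidable-stable (z 𝔹.≟ true) (λ z≢ → ¬exc ((λ (s , _) → z≢ (Supp-zero⁻ s)) , odd , refl))
           , decidable-stable (o 𝔹.≟ true) (λ o≢ → ¬exc ((λ (_ , s) → o≢ (Supp-one⁻ s)) , odd , refl))
    step (suc (suc r)) _ (s≤s (s≤s ())) _ _

theorem3p2 :
    (n k : ℕ) → 1 ≤ n → 1 < k → (c : Bool) (A : InitialChoice) →
    let μ : Distribution n
        μ = initial A
        π : ℕ → Distribution n
        π = growth μ (linearConnective k c)
        Exceptional : Set
        Exceptional = ¬ (Supp μ (constant false) × Supp μ (constant true)) × k % 2 ≡ 1 × c ≡ true
    in
    (∀ j → ¬ Supp μ (negatedProjection j)) →
    (Exceptional →
      (∃[ S ] ∃[ H₀ ] ∃[ H₁ ]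
        S Enumerates ProcessSupp π × H₀ HalfOf S × H₁ HalfOf S ×
        AlternatingLimits π (uniform H₀) (uniform H₁))
      × (¬ Supp μ (constant false) → ¬ Supp μ (constant true) →
          ∀ f → ProcessSupp π f ⇔ (∃[ c₀ ] ∃[ cs ] parity cs ≡ true × f ≗ linear c₀ cs))
      × (Supp μ (constant false) ⊎ Supp μ (constant true) →
          ∀ f → ProcessSupp π f ⇔ Linear f))
    × (¬ Exceptional →
      ∃[ S ] S Enumerates ProcessSupp π × (π ⟶ uniform S))
-- A negated projection in the initial set would be in the support.
theorem3p2 (suc m) k 1≤n 1<k c record { withNegations = true ; withZero = z ; withOne = o } no-negation =
  ⊥-elim (no-negation zero (uniform-∈
    (∈ₚ.∈-++⁺ʳ (BoolFunSetoid (suc m)) (map projection (allFin (suc m))) (here (λ _ → refl)))))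
theorem3p2 (suc m) k 1≤n 1<k c record { withNegations = false ; withZero = z ; withOne = o } no-negation =
  exceptional , unexceptional
  where
  open ProjectionProcess m k 1<k c z o _ refl
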